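{- Let $i\ge 3$ and $k\ge 3$ be integers. Then: (a) $n_1(F_i,F_{i+2},F_{i+k})=\tfrac12\bigl(3F_iF_{i+2}-F_i-F_{i+2}+1\bigr)$ whenever $k\ge i+2$; (b) for $k\in\{i,i+1\}$, $n_1(F_i,F_{i+2},F_{i+k})=\tfrac12\bigl(3F_iF_{i+2}-F_i-F_{i+2}+1\bigr)-(2F_i-F_k)F_{k-2}$; (c) if $r=\lfloor (F_i-1)/F_k\rfloor\ge 1$ (equivalently $k\le i-1$), then $$n_1(F_i,F_{i+2},F_{i+k})=\tfrac12\bigl((F_i+2F_k-1)F_{i+2}-F_i+1\bigr)-\Bigl(rF_i-\frac{(r-1)(r+2)}{2}F_k\Bigr)F_{k-2}.$$
   Context: Fibonacci numbers: $F_0=0$, $F_1=1$, $F_n=F_{n-1}+F_{n-2}$. For positive integers $a_1,\dots,a_l$ with $\gcd(a_1,\dots,a_l)=1$ and an integer $n$, let $d(n;a_1,\dots,a_l)$ be the number of tuples $(x_1,\dots,x_l)$ of nonnegative integers with $a_1x_1+\dots+a_lx_l=n$. For a nonnegative integer $p$, the $p$-Sylvester number $n_p(a_1,\dots,a_l)$ is the number of nonnegative integers $n$ with $d(n;a_1,\dots,a_l)\le p$. -}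

module Defs where

open import Level using (Level; _⊔_)
open import Data.Integer.Base using (+_)
open import Data.List.Base using (length)
open import Data.List.Membership.Propositional using (_∈_)
open import Data.List.Relation.Unary.Unique.Propositional using (Unique)
open import Data.Nat.Base using (ℕ; zero; suc; _+_; _*_; _≤_; NonZero; >-nonZero)
open import Data.Nat.Properties using (m≤m+n; ≤-trans)
open import Data.Product.Base using (∃-syntax; _×_)
open import Data.Rational.Base using (ℚ)
open import Data.Rational.Literals using (fromℤ)
open import Data.Vec.Base using (Vec; sum; zipWith)
open import Function.Bundles using (_⇔_)
open import Relation.Binary.PropositionalEquality.Core using (_≡_)
open import Relation.Unary using (Pred)

private
  variable
    a p : Level
    l   : ℕ

F : ℕ → ℕ
F zero          = 0
F (suc zero)    = 1
F (suc (suc n)) = F (suc n) + F n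

1≤F-suc : ∀ n → 1 ≤ F (suc n)
1≤F-suc zero    = m≤m+n 1 0
1≤F-suc (suc n) = ≤-trans (1≤F-suc n) (m≤m+n (F (suc n)) (F n))

F-nonZero : ∀ {k} → 3 ≤ k → NonZero (F k)
F-nonZero {suc k} _ = >-nonZero (1≤F-suc k)

fromℕ : ℕ → ℚ
fromℕ n = fromℤ (+ n)

-- The subset { x | P x } of A is finite with exactly N elements: it is listed
-- without repetition by a list of length N.  The proofs of P x are not counted,
-- so P need not be proof-irrelevant.
HasSize : {A : Set a} → Pred A p → ℕ → Set (a ⊔ p)
HasSize P N =
  ∃[ xs ] Unique xs × (∀ x → x ∈ xs ⇔ P x) × length xs ≡ N

-- d(n; a₁,…,aₗ) = m
IsDenumerant : Vec ℕ l → ℕ → ℕ → Set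
IsDenumerant {l} as n m = HasSize {A = Vec ℕ l} (λ xs → sum (zipWith _*_ as xs) ≡ n) m

-- n_p(a₁,…,aₗ) = N.  When every aᵢ is positive, d(n; a₁,…,aₗ) exists for
-- every n, and when moreover gcd(a₁,…,aₗ) = 1, so does n_p(a₁,…,aₗ).
IsSylvester : ℕ → Vec ℕ l → ℕ → Set
IsSylvester p as N = HasSize (λ n → ∃[ m ] IsDenumerant as n m × m ≤ p) N

{-# OPTIONS --safe #-}
module Submission where

-- Write a = F i, b = F (i+2), c = F (i+k), K = F k and L = F (k−2); then c = K b − L a.
-- A solution (x, y, z) of a x + b y + c z = n is the same as a presentation of n as
-- a (x − L z) + b u with u = y + K z, and for n ≡ b t mod a with t < a this forces
-- u = t + s a.  Comparing the solutions with s = 0 and s ≥ 1 shows that the least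
-- element with two solutions in the class of b t is
--   b ((t+a) mod K) + c ⌊(t+a)/K⌋        if t < K,
--   b (t′ mod K + K) + c ⌊t′/K⌋          if t = K + t′.
-- The number n₁ is the sum over t < a of the quotients of these thresholds by a.  It is
-- evaluated with Σ ⌊b t/a⌋ = (a−1)(b−1)/2 and Hermite's identity Σ_{t<K} ⌊(t+n)/K⌋ = n.

open import Defs
open import Data.Empty using (⊥; ⊥-elim)
open import Data.List.Base using (List; []; _∷_; _++_; map; length; upTo; applyUpTo)
open import Data.List.Membership.Propositional using (_∈_)
open import Data.List.Membership.Propositional.Properties
  using (∈-++⁺ˡ; ∈-++⁺ʳ; ∈-++⁻; ∈-map⁺; ∈-map⁻; ∈-upTo⁺; ∈-upTo⁻)
open import Data.List.Properties using (length-++; length-map; length-upTo)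
open import Data.List.Relation.Unary.All using ([])
open import Data.List.Relation.Unary.AllPairs using ([]; _∷_)
open import Data.List.Relation.Unary.Any using (here)
import Data.List.Relation.Unary.Unique.Propositional.Properties as Unique
open import Data.Nat.Base as ℕ using (ℕ; zero; suc; _≤_; _∸_; z≤n; s≤s; s≤s⁻¹)
open import Data.Nat.Coprimality using (Coprime; coprime-Bézout; coprime-divisor)
open import Data.Nat.Divisibility
  using (_∣_; divides; divides-refl; ∣⇒≤; ∣1⇒≡1; ∣m+n∣m⇒∣n; m%n≡0⇒n∣m)
import Data.Nat.DivMod as ℕ
open import Data.Nat.GCD using (module Bézout)
open import Data.Nat.ListAction using (sum)
import Data.Nat.Properties as ℕ
open import Data.Nat.Tactic.RingSolver using (solve-∀)
open import Data.Product.Base using (_×_; ∃-syntax; _,_)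
open import Data.Sum.Base using (_⊎_; inj₁; inj₂)
open import Data.Vec.Base as Vec using (Vec; _∷_; [])
import Data.Vec.Properties as Vec
open import Function.Base using (_∘_; case_of_)
open import Function.Bundles using (_⇔_; mk⇔; Equivalence)
open import Level using (Level)
open import Relation.Binary.PropositionalEquality
open import Relation.Nullary using (¬_; Dec; yes; no)
open import Relation.Nullary.Decidable using (map′; _×-dec_)
open import Relation.Unary using (Pred)

open Equivalence using (to; from)

-- In the class of b t, a pair (s, z) with K z ≤ t + s a determines y, and it gives a solution of n
-- exactly when n ≥ b (t + s a) - L a z, since x is then a nonnegative integer. Each pair thus has
-- an entry value, and the threshold of the class is its second smallest entry value. For s = 0 a
-- larger z enters earlier, so if t ≥ K the first two entries belong to the two largest z. If t < K,
-- only z = 0 exists for s = 0, and the second entry is that of s = 1 with the largest z. The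
-- delicate point is that no pair with a larger s, which leaves more room for z, enters earlier.
-- This reduces to L K ≤ c for low residues and 2 L K ≤ c for high ones. The first can fail when k
-- is large, but a is then so small against K that the crude estimate 3 L a ≤ K b takes its place.
-- The ranges of k differ in the correction term: the floors ⌊(t+a)/K⌋ for t < a all vanish in (a)
-- and take only the values 0 and 1 in (b), while residues t ≥ K occur only in (c).

module NaturalNumbers where

  open import Data.Nat.Base
  open import Data.Nat.DivMod
  open import Data.Nat.Properties

  private
    variable
      ℓ ℓ′ : Level
      A : Set ℓ
      l m n : ℕ

  -- Sizes of finite sets and of their disjoint unions.

  Σ< : ℕ → (ℕ → ℕ) → ℕ
  Σ< n f = sum (applyUpTo f n)

  HasSize-resp : {P : Pred A ℓ} {Q : Pred A ℓ′} →
                 (∀ x → P x → Q x) → (∀ x → Q x → P x) → HasSize P n → HasSize Q n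
  HasSize-resp f g (xs , u , e , len) =
    xs , u , (λ x → mk⇔ (f x ∘ to (e x)) (from (e x) ∘ g x)) , len

  HasSize-⊎ : {P : Pred A ℓ} {Q : Pred A ℓ′} → (∀ x → P x → Q x → ⊥) →
              HasSize P m → HasSize Q n → HasSize (λ x → P x ⊎ Q x) (m + n)
  HasSize-⊎ {P = P} {Q} disj (xs , u , e , refl) (ys , v , f , refl) =
    xs ++ ys ,
    Unique.++⁺ u v (λ (p , q) → disj _ (to (e _) p) (to (f _) q)) ,
    (λ x → mk⇔ (fwd x) (bwd x)) ,
    length-++ xs
    where
    fwd : ∀ x → x ∈ xs ++ ys → P x ⊎ Q x
    fwd x p with ∈-++⁻ xs p
    ... | inj₁ q = inj₁ (to (e x) q)
    ... | inj₂ q = inj₂ (to (f x) q)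
    bwd : ∀ x → P x ⊎ Q x → x ∈ xs ++ ys
    bwd x (inj₁ p) = ∈-++⁺ˡ (from (e x) p)
    bwd x (inj₂ q) = ∈-++⁺ʳ xs (from (f x) q)

  HasSize-⋃ : (P : ℕ → Pred A ℓ) (f : ℕ → ℕ) (n : ℕ) →
              (∀ t → t < n → HasSize (P t) (f t)) →
              (∀ s t x → s < n → t < n → P s x → P t x → s ≡ t) →
              HasSize (λ x → ∃[ t ] t < n × P t x) (Σ< n f)
  HasSize-⋃ P f zero    _  _    = [] , [] , (λ x → mk⇔ (λ ()) (λ ())) , refl
  HasSize-⋃ P f (suc n) hs disj = HasSize-resp
    (λ { x (inj₁ p) → 0 , z<s , p ; x (inj₂ (t , t<n , p)) → suc t , s<s t<n , p })
    (λ { x (zero , _ , p) → inj₁ p ; x (suc t , t<n , p) → inj₂ (t , s<s⁻¹ t<n , p) })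
    (HasSize-⊎ (λ { x p (t , t<n , q) → case disj 0 (suc t) x z<s (s<s t<n) p q of λ () })
      (hs 0 z<s)
      (HasSize-⋃ (P ∘ suc) (f ∘ suc) n (λ t → hs (suc t) ∘ s<s)
        (λ s t x s<n t<n p q → suc-injective (disj (suc s) (suc t) x (s<s s<n) (s<s t<n) p q))))

  HasSize-image : (f : ℕ → A) → (∀ {i j} → f i ≡ f j → i ≡ j) → ∀ n →
                  HasSize (λ x → ∃[ j ] j < n × x ≡ f j) n
  HasSize-image f inj n =
    map f (upTo n) , Unique.map⁺ inj (Unique.upTo⁺ n) ,
    (λ x → mk⇔ (λ p → let j , q , eq = ∈-map⁻ f p in j , ∈-upTo⁻ q , eq)
               (λ { (j , j<n , refl) → ∈-map⁺ f (∈-upTo⁺ j<n) })) ,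
    trans (length-map f (upTo n)) (length-upTo n)

  -- The set consists of the members of the class of `T` that lie strictly below `T`, namely
  -- `T % a + j * a` for `j < T / a`.
  HasSize-below : ∀ a .{{_ : NonZero a}} T → HasSize (λ n → ∃[ j ] n + suc j * a ≡ T) (T / a)
  HasSize-below a T = HasSize-resp fwd bwd
    (HasSize-image (λ j → T % a + j * a) (λ {i} {j} eq → *-cancelʳ-≡ i j a (+-cancelˡ-≡ (T % a) _ _ eq)) (T / a))
    where
    lem : ∀ r j k d → (r + j * d) + suc k * d ≡ r + (suc j + k) * d
    lem = solve-∀
    fwd : ∀ n → (∃[ j ] j < T / a × n ≡ T % a + j * a) → ∃[ j ] n + suc j * a ≡ T
    fwd n (j , j<q , refl) with k , eq ← m≤n⇒∃[o]m+o≡n j<q =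
      k , trans (lem (T % a) j k a) (trans (cong (λ q → T % a + q * a) eq) (sym (m≡m%n+[m/n]*n T a)))
    bwd : ∀ n → (∃[ j ] n + suc j * a ≡ T) → ∃[ j ] j < T / a × n ≡ T % a + j * a
    bwd n (j , refl) =
      n / a ,
      subst (n / a <_) (sym (trans (+-distrib-/-∣ʳ n (divides-refl (suc j))) (cong (n / a +_) (m*n/n≡m (suc j) a))))
        (m<m+n (n / a) z<s) ,
      trans (m≡m%n+[m/n]*n n a) (cong (_+ n / a * a) (sym ([m+kn]%n≡m%n n (suc j) a)))

  -- Uniqueness of solutions, and the reduction of the count to one threshold per residue class.

  Solves : Vec ℕ l → ℕ → Vec ℕ l → Set
  Solves as n v = Vec.sum (Vec.zipWith _*_ as v) ≡ n

  -- A denumerant is witnessed by an explicit list, so uniqueness alone does not produce one: it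
  -- must be decided whether the list is empty or a singleton. A zero coefficient is treated apart
  -- because `n` then puts no bound on its variable.
  solvable? : (as : Vec ℕ l) (n : ℕ) → Dec (∃[ v ] Solves as n v)
  solvable? []           zero    = yes ([] , refl)
  solvable? []           (suc n) = no λ { ([] , ()) }
  solvable? (zero  ∷ as) n       =
    map′ (λ { (v , eq) → 0 ∷ v , eq }) (λ { (x ∷ v , eq) → v , eq }) (solvable? as n)
  solvable? (suc a ∷ as) n       = map′ fwd bwd
    (anyUpTo? (λ x → (suc a * x ≤? n) ×-dec solvable? as (n ∸ suc a * x)) (suc n))
    where
    fwd : (∃[ x ] x < suc n × suc a * x ≤ n × (∃[ v ] Solves as (n ∸ suc a * x) v)) → _
    fwd (x , _ , le , v , eq) = x ∷ v , trans (cong (suc a * x +_) eq) (m+[n∸m]≡n le)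
    bwd : (∃[ v ] Solves (suc a ∷ as) n v) → _
    bwd (x ∷ v , refl) =
      x , s≤s (≤-trans (m≤m+n x (a * x)) (m≤m+n (suc a * x) _)) , m≤m+n (suc a * x) _ , v ,
      sym (m+n∸m≡n (suc a * x) _)

  AtMostOneSolution : Vec ℕ l → ℕ → Set
  AtMostOneSolution as n = ∀ v w → Solves as n v → Solves as n w → v ≡ w

  module _ (as : Vec ℕ l) (n : ℕ) where

    denumerant≤1⇒unique : (∃[ m ] IsDenumerant as n m × m ≤ 1) → AtMostOneSolution as n
    denumerant≤1⇒unique (_ , (vs , _ , e , refl) , le) v w p q =
      lem vs le (from (e v) p) (from (e w) q)
      where
      lem : ∀ (vs : List (Vec ℕ l)) → length vs ≤ 1 → v ∈ vs → w ∈ vs → v ≡ w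
      lem (_ ∷ []) _ (here refl) (here refl) = refl
      lem (_ ∷ _ ∷ _) (s≤s ())

    unique⇒denumerant≤1 : AtMostOneSolution as n → ∃[ m ] IsDenumerant as n m × m ≤ 1
    unique⇒denumerant≤1 uniq with solvable? as n
    ... | yes (v , p) = 1 , (v ∷ [] , [] ∷ [] , e , refl) , ≤-refl
      where
      e : ∀ w → w ∈ v ∷ [] ⇔ Solves as n w
      e w = mk⇔ (λ { (here refl) → p }) (λ q → here (uniq w v q p))
    ... | no ¬p = 0 , ([] , [] , (λ w → mk⇔ (λ ()) (λ q → ⊥-elim (¬p (w , q)))) , refl) , z≤n

  -- Multiples are added on both sides, so that neither subtraction nor an order between `m` and `n`
  -- is involved.
  Congruent : ℕ → ℕ → ℕ → Set
  Congruent a m n = ∃[ p ] ∃[ q ] m + p * a ≡ n + q * a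

  -- The last two hypotheses say that T t is the least element of its class with two solutions.
  sylvester₁ : ∀ a .{{_ : NonZero a}} (as : Vec ℕ l) (T : ℕ → ℕ) →
    (∀ n → ∃[ t ] t < a × Congruent a n (T t)) →
    (∀ s t → s < a → t < a → Congruent a (T s) (T t) → s ≡ t) →
    (∀ t → t < a → ¬ AtMostOneSolution (a ∷ as) (T t)) →
    (∀ t n → t < a → n < T t → Congruent a n (T t) → AtMostOneSolution (a ∷ as) n) →
    IsSylvester 1 (a ∷ as) (Σ< a (λ t → T t / a))
  sylvester₁ {l} a as T surj inj two one = HasSize-resp fwd bwd
    (HasSize-⋃ (λ t n → ∃[ j ] n + suc j * a ≡ T t) (λ t → T t / a) a
      (λ t _ → HasSize-below a (T t))
      (λ { s t n s<a t<a (i , eq) (j , eq′) → inj s t s<a t<a (suc j , suc i , (begin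
         T s + suc j * a             ≡⟨ cong (_+ suc j * a) eq ⟨
         n + suc i * a + suc j * a   ≡⟨ comm n (suc i * a) (suc j * a) ⟩
         n + suc j * a + suc i * a   ≡⟨ cong (_+ suc i * a) eq′ ⟩
         T t + suc i * a             ∎)) }))
    where
    open ≡-Reasoning
    comm : ∀ x y z → x + y + z ≡ x + z + y
    comm = solve-∀
    -- Adding `j` to the first coordinate embeds the solutions for `n` into those for `n + j * a`,
    -- so having two solutions persists upwards in a class.
    shift : ∀ {n} j → ¬ AtMostOneSolution (a ∷ as) n → ¬ AtMostOneSolution (a ∷ as) (n + j * a)
    shift {n} j ¬u u = ¬u λ { (x ∷ v) (y ∷ w) p q →
      let eq = u (x + j ∷ v) (y + j ∷ w) (move x v p) (move y w q)
      in cong₂ _∷_ (+-cancelʳ-≡ j x y (Vec.∷-injectiveˡ eq)) (Vec.∷-injectiveʳ eq) }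
      where
      lem : ∀ d x j S → d * (x + j) + S ≡ d * x + S + j * d
      lem = solve-∀
      move : ∀ x v → Solves (a ∷ as) n (x ∷ v) → Solves (a ∷ as) (n + j * a) (x + j ∷ v)
      move x v refl = lem a x j _
    fwd : ∀ n → (∃[ t ] t < a × ∃[ j ] n + suc j * a ≡ T t) → _
    fwd n (t , t<a , j , eq) = unique⇒denumerant≤1 (a ∷ as) n
      (one t n t<a (subst (n <_) eq (m<m+n n (≤-trans (>-nonZero⁻¹ a) (m≤m+n a _))))
        (suc j , 0 , trans eq (sym (+-identityʳ _))))
    bwd : ∀ n → _ → ∃[ t ] t < a × ∃[ j ] n + suc j * a ≡ T t
    bwd n d with surj n
    -- The order of `p` and `q` tells whether `n` lies below `T t`; if it does not, the two
    -- solutions at `T t` persist up to `n`.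
    ... | t , t<a , p , q , eq with p ≤? q
    ...   | no p≰q = t , t<a , let k , e = m≤n⇒∃[o]m+o≡n (≰⇒> p≰q) in k , +-cancelʳ-≡ (q * a) _ _ (begin
              n + suc k * a + q * a ≡⟨ lem n k q a ⟩
              n + (suc q + k) * a   ≡⟨ cong (λ r → n + r * a) e ⟩
              n + p * a             ≡⟨ eq ⟩
              T t + q * a ∎)
      where
      lem : ∀ n k q a → n + suc k * a + q * a ≡ n + (suc q + k) * a
      lem = solve-∀
    ...   | yes p≤q with k , e ← m≤n⇒∃[o]m+o≡n p≤q =
      ⊥-elim (shift k (two t t<a) (subst (AtMostOneSolution (a ∷ as)) n≡ (denumerant≤1⇒unique (a ∷ as) n d)))
      where
      lem : ∀ T p k a → T + (p + k) * a ≡ T + k * a + p * a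
      lem = solve-∀
      n≡ : n ≡ T t + k * a
      n≡ = +-cancelʳ-≡ (p * a) _ _ (trans eq (trans (cong (λ r → T t + r * a) (sym e)) (lem (T t) p k a)))

  -- Multiplication by `b` on the residues modulo `a`.

  module Congruence (a b : ℕ) .{{_ : NonZero a}} (a⊥b : Coprime a b) where

    private
      divides-difference : ∀ t d p q → b * (t + d) + p * a ≡ b * t + q * a → a ∣ b * d
      divides-difference t d p q eq = divides (q ∸ p) (begin
        b * d                 ≡⟨ m+n∸n≡m (b * d) (p * a) ⟨
        b * d + p * a ∸ p * a ≡⟨ cong (_∸ p * a) (+-cancelˡ-≡ (b * t) _ _ (trans (lem b t d (p * a)) eq)) ⟩
        q * a ∸ p * a         ≡⟨ *-distribʳ-∸ a q p ⟨
        (q ∸ p) * a           ∎)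
        where
        open ≡-Reasoning
        lem : ∀ b t d x → b * t + (b * d + x) ≡ b * (t + d) + x
        lem = solve-∀

      cancel-≤ : ∀ u t p q → b * u + p * a ≡ b * t + q * a → t ≤ u → ∃[ s ] u ≡ t + s * a
      cancel-≤ u t p q eq t≤u with d , refl ← m≤n⇒∃[o]m+o≡n t≤u
        with divides s refl ← coprime-divisor {o = d} a⊥b (divides-difference t d p q eq)
        = s , refl

    -- Coprimality makes `u` and `t` differ by a multiple of `a`, and `t < a` leaves no room for `u`
    -- to be smaller by a positive multiple.
    cancel : ∀ u t → t < a → Congruent a (b * u) (b * t) → ∃[ s ] u ≡ t + s * a
    cancel u t t<a (p , q , eq) with t ≤? u
    ... | yes t≤u = cancel-≤ u t p q eq t≤u
    ... | no  t≰u with cancel-≤ t u q p (sym eq) (<⇒≤ (≰⇒> t≰u))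
    ...   | zero  , eq′ = 0 , trans (sym (+-identityʳ u)) (trans (sym eq′) (sym (+-identityʳ t)))
    ...   | suc s , eq′ = ⊥-elim (<⇒≱ t<a (subst (a ≤_) (sym eq′)
                            (≤-trans (m≤m+n a (s * a)) (m≤n+m (suc s * a) u))))

    cancel-< : ∀ s t → s < a → t < a → Congruent a (b * s) (b * t) → s ≡ t
    cancel-< s t s<a t<a cg with cancel s t t<a cg
    ... | zero  , eq = trans eq (+-identityʳ t)
    ... | suc k , eq = ⊥-elim (<⇒≱ s<a (subst (a ≤_) (sym eq)
                         (≤-trans (m≤m+n a (k * a)) (m≤n+m (suc k * a) t))))

    private
      reduce : ∀ n u → Congruent a n (b * u) → ∃[ t ] t < a × Congruent a n (b * t)
      reduce n u (p , q , eq) = u % a , m%n<n u a , p , q + b * (u / a) , (begin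
        n + p * a                                    ≡⟨ eq ⟩
        b * u + q * a                                ≡⟨ cong (λ v → b * v + q * a) (m≡m%n+[m/n]*n u a) ⟩
        b * (u % a + u / a * a) + q * a              ≡⟨ lem b (u % a) (u / a) a q ⟩
        b * (u % a) + (q + b * (u / a)) * a          ∎)
        where
        open ≡-Reasoning
        lem : ∀ b r k a q → b * (r + k * a) + q * a ≡ b * r + (q + b * k) * a
        lem = solve-∀

    residue : ∀ n → ∃[ t ] t < a × Congruent a n (b * t)
    residue n with coprime-Bézout a⊥b
    ... | Bézout.-+ x y eq = reduce n (n * y) (n * x , 0 , (begin
            n + n * x * a       ≡⟨ lem n x a ⟩
            n * (1 + x * a)     ≡⟨ cong (n *_) eq ⟩
            n * (y * b)         ≡⟨ lem₂ n y b ⟩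
            b * (n * y) + 0     ∎))
      where
      open ≡-Reasoning
      lem : ∀ n x a → n + n * x * a ≡ n * (1 + x * a)
      lem = solve-∀
      lem₂ : ∀ n y b → n * (y * b) ≡ b * (n * y) + 0
      lem₂ = solve-∀
    -- Here − y inverts b modulo a, and (a − 1) y replaces it.
    ... | Bézout.+- x y eq = reduce n (n * (y * pred a)) (n * y * b , n * x , (begin
            n + n * y * b * a                         ≡⟨ cong (λ z → n + n * y * b * z) (suc-pred a) ⟨
            n + n * y * b * suc (pred a)              ≡⟨ lem n y b (pred a) ⟩
            b * (n * (y * pred a)) + n * (1 + y * b)  ≡⟨ cong (λ z → b * (n * (y * pred a)) + n * z) eq ⟩
            b * (n * (y * pred a)) + n * (x * a)      ≡⟨ cong (b * (n * (y * pred a)) +_) (*-assoc n x a) ⟨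
            b * (n * (y * pred a)) + n * x * a        ∎))
      where
      open ≡-Reasoning
      lem : ∀ n y b e → n + n * y * b * suc e ≡ b * (n * (y * e)) + n * (1 + y * b)
      lem = solve-∀

  Congruent-sym : ∀ {a m n} → Congruent a m n → Congruent a n m
  Congruent-sym (p , q , eq) = q , p , sym eq

  Congruent-trans : ∀ {a m n o} → Congruent a m n → Congruent a n o → Congruent a m o
  Congruent-trans {a} {m} {n} {o} (p , q , eq) (p′ , q′ , eq′) = p + p′ , q + q′ , (begin
    m + (p + p′) * a        ≡⟨ lem m p p′ a ⟩
    m + p * a + p′ * a      ≡⟨ cong (_+ p′ * a) eq ⟩
    n + q * a + p′ * a      ≡⟨ lem₂ n (q * a) (p′ * a) ⟩
    n + p′ * a + q * a      ≡⟨ cong (_+ q * a) eq′ ⟩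
    o + q′ * a + q * a      ≡⟨ lem₃ o q q′ a ⟩
    o + (q + q′) * a        ∎)
    where
    open ≡-Reasoning
    lem : ∀ m p q a → m + (p + q) * a ≡ m + p * a + q * a
    lem = solve-∀
    lem₂ : ∀ m p q → m + p + q ≡ m + q + p
    lem₂ = solve-∀
    lem₃ : ∀ m p q a → m + q * a + p * a ≡ m + (p + q) * a
    lem₃ = solve-∀

  -- The least number with two solutions in each residue class.

  module Threshold (a b c K L : ℕ) .{{_ : NonZero a}} .{{_ : NonZero K}}
    (a⊥b : Coprime a b) (Kb≡La+c : K * b ≡ L * a + c) where

    open Congruence a b a⊥b

    -- Both values come from solutions with x = 0. For `low t` it is the one with s = 1 and the
    -- greatest z. The argument of `high` is the excess over `K`: it belongs to the residue `K + t`,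
    -- with s = 0 and z one less than its greatest value.
    low high threshold : ℕ → ℕ
    low  t = b * ((t + a) % K) + c * ((t + a) / K)
    high t = b * (t % K + K) + c * (t / K)
    threshold t with t <? K
    ... | yes _ = low t
    ... | no  _ = high (t ∸ K)

    threshold-low : ∀ {t} → t < K → threshold t ≡ low t
    threshold-low {t} t<K with t <? K
    ... | yes _   = refl
    ... | no  t≮K = ⊥-elim (t≮K t<K)

    threshold-high : ∀ t → threshold (K + t) ≡ high t
    threshold-high t with K + t <? K
    ... | yes lt = ⊥-elim (<⇒≱ lt (m≤m+n K t))
    ... | no  _  = cong high (m+n∸m≡n K t)

    balance : ∀ y z → b * y + c * z + L * a * z ≡ b * (y + K * z)
    balance y z = begin
      b * y + c * z + L * a * z ≡⟨ lem b y c z (L * a) ⟩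
      b * y + (L * a + c) * z   ≡⟨ cong (λ e → b * y + e * z) Kb≡La+c ⟨
      b * y + K * b * z         ≡⟨ lem₂ b y z K ⟩
      b * (y + K * z)           ∎
      where
      open ≡-Reasoning
      lem : ∀ b y c z e → b * y + c * z + e * z ≡ b * y + (e + c) * z
      lem = solve-∀
      lem₂ : ∀ b y z K → b * y + K * b * z ≡ b * (y + K * z)
      lem₂ = solve-∀

    private
      divMod : ∀ n → n % K + K * (n / K) ≡ n
      divMod n = trans (cong (n % K +_) (*-comm K (n / K))) (sym (m≡m%n+[m/n]*n n K))

    low-balance : ∀ t → low t + L * a * ((t + a) / K) ≡ b * (t + a)
    low-balance t = trans (balance ((t + a) % K) ((t + a) / K)) (cong (b *_) (divMod (t + a)))

    high-balance : ∀ t → high t + L * a * (t / K) ≡ b * (K + t)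
    high-balance t = trans (balance (t % K + K) (t / K)) (cong (b *_) (begin
      t % K + K + K * (t / K)   ≡⟨ lem (t % K) K (K * (t / K)) ⟩
      K + (t % K + K * (t / K)) ≡⟨ cong (K +_) (divMod t) ⟩
      K + t                     ∎))
      where
      open ≡-Reasoning
      lem : ∀ x y z → x + y + z ≡ y + (x + z)
      lem = solve-∀

    data View (t : ℕ) : Set where
      isLow  : t < K → View t
      isHigh : ∀ t′ → t ≡ K + t′ → View t

    view : ∀ t → View t
    view t with t <? K
    ... | yes t<K = isLow t<K
    ... | no  t≮K = isHigh (t ∸ K) (sym (m+[n∸m]≡n (≮⇒≥ t≮K)))

    threshold≡bt : ∀ t → Congruent a (threshold t) (b * t)
    threshold≡bt t with view t
    ... | isLow t<K rewrite threshold-low t<K =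
      L * ((t + a) / K) , b , (begin
        low t + L * q * a   ≡⟨ cong (low t +_) (lem L q a) ⟩
        low t + L * a * q   ≡⟨ low-balance t ⟩
        b * (t + a)         ≡⟨ *-distribˡ-+ b t a ⟩
        b * t + b * a       ∎)
      where
      open ≡-Reasoning
      q = (t + a) / K
      lem : ∀ L q a → L * q * a ≡ L * a * q
      lem = solve-∀
    ... | isHigh t′ refl rewrite threshold-high t′ =
      L * (t′ / K) , 0 , (begin
        high t′ + L * (t′ / K) * a   ≡⟨ cong (high t′ +_) (lem L (t′ / K) a) ⟩
        high t′ + L * a * (t′ / K)   ≡⟨ high-balance t′ ⟩
        b * (K + t′)                 ≡⟨ +-identityʳ _ ⟨
        b * (K + t′) + 0             ∎)
      where
      open ≡-Reasoning
      lem : ∀ L q a → L * q * a ≡ L * a * q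
      lem = solve-∀

    as : Vec ℕ 3
    as = a ∷ b ∷ c ∷ []

    -- Trading the third generator for the second (c = K b − L a) gives
    -- n = a (x − L z) + b (t + s a); the term L a z stands on the left to avoid subtraction.
    solution-shape : ∀ {n t x y z} → t < a → Congruent a n (b * t) → Solves as n (x ∷ y ∷ z ∷ []) →
      ∃[ s ] y + K * z ≡ t + s * a × n + L * a * z ≡ a * x + b * (t + s * a)
    solution-shape {n} {t} {x} {y} {z} t<a (p , q , eq) refl
      = let s , e = cancel (y + K * z) t t<a u≡t in s , e , (begin
        n + L * a * z                         ≡⟨ lem₃ a x b y c z L ⟩
        a * x + (b * y + c * z + L * a * z)   ≡⟨ cong (a * x +_) (balance y z) ⟩
        a * x + b * (y + K * z)               ≡⟨ cong (λ u → a * x + b * u) e ⟩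
        a * x + b * (t + s * a)               ∎)
      where
      open ≡-Reasoning
      lem : ∀ a x b y c z L p → b * y + c * z + L * a * z + (x + p) * a
                              ≡ a * x + (b * y + (c * z + 0)) + p * a + L * z * a
      lem = solve-∀
      lem₂ : ∀ u q a w → u + q * a + w * a ≡ u + (q + w) * a
      lem₂ = solve-∀
      lem₃ : ∀ a x b y c z L → a * x + (b * y + (c * z + 0)) + L * a * z
                             ≡ a * x + (b * y + c * z + L * a * z)
      lem₃ = solve-∀
      u≡t : Congruent a (b * (y + K * z)) (b * t)
      u≡t = x + p , q + L * z , (begin
        b * (y + K * z) + (x + p) * a                     ≡⟨ cong (_+ (x + p) * a) (balance y z) ⟨
        b * y + c * z + L * a * z + (x + p) * a           ≡⟨ lem a x b y c z L p ⟩
        a * x + (b * y + (c * z + 0)) + p * a + L * z * a ≡⟨ cong (_+ L * z * a) eq ⟩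
        b * t + q * a + L * z * a                         ≡⟨ lem₂ (b * t) q a (L * z) ⟩
        b * t + (q + L * z) * a                           ∎)

    -- When s = 0, z fixes y through `y + K * z ≡ t`, and `n` then fixes x.
    solution-unique : ∀ {n t z x y x′ y′ z′} →
      y + K * z ≡ t → y′ + K * z′ ≡ t → z ≡ z′ →
      Solves as n (x ∷ y ∷ z ∷ []) → Solves as n (x′ ∷ y′ ∷ z′ ∷ []) →
      _≡_ {A = Vec ℕ 3} (x ∷ y ∷ z ∷ []) (x′ ∷ y′ ∷ z′ ∷ [])
    solution-unique {z = z} {x} {y} {x′} {y′} e e′ refl p p′
      with refl ← +-cancelʳ-≡ (K * z) y y′ (trans e (sym e′))
      with refl ← *-cancelˡ-≡ x x′ a (+-cancelʳ-≡ _ (a * x) (a * x′) (trans p (sym p′)))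
      = refl

    -- These inequalities are parameters because their proofs depend on the range of k. `low-min`
    -- and `high-min` say that no solution with larger s undercuts the threshold; in `low-min` the
    -- variable `s` counts the multiples of `a` beyond the first. `low-rep` makes the coordinate x
    -- of the solution with z = 0 nonnegative at `low t`.
    module _
      (low-min : ∀ t s z → t < K → t < a → K * z ≤ t + a + s * a → L * z ≤ b * s + L * ((t + a) / K))
      (low-rep : ∀ t → t < K → t < a → L * ((t + a) / K) ≤ b)
      (high-min : ∀ t s z → K + t < a → K * z ≤ K + t + suc s * a → L * z ≤ b * suc s + L * (t / K))
      where

      private
        low≤ : ∀ {n t x z} s → t < K → t < a → K * z ≤ t + suc s * a →
               n + L * a * z ≡ a * x + b * (t + suc s * a) → low t ≤ n
        low≤ {n} {t} {x} {z} s t<K t<a le eq = +-cancelʳ-≤ (L * a * q + b * s * a) _ _ (begin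
          low t + (L * a * q + b * s * a)  ≡⟨ +-assoc (low t) _ _ ⟨
          low t + L * a * q + b * s * a    ≡⟨ cong (_+ b * s * a) (low-balance t) ⟩
          b * (t + a) + b * s * a          ≡⟨ lem b t a s ⟩
          b * (t + suc s * a)              ≤⟨ m≤n+m _ (a * x) ⟩
          a * x + b * (t + suc s * a)      ≡⟨ eq ⟨
          n + L * a * z                    ≡⟨ cong (n +_) (lem₂ L a z) ⟩
          n + L * z * a                    ≤⟨ +-monoʳ-≤ n (*-monoˡ-≤ a (low-min t s z t<K t<a (subst (K * z ≤_) (sym (+-assoc t a (s * a))) le))) ⟩
          n + (b * s + L * q) * a          ≡⟨ lem₃ n b s L q a ⟩
          n + (L * a * q + b * s * a)      ∎)
          where
          open ≤-Reasoning
          q = (t + a) / K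
          lem : ∀ b t a s → b * (t + a) + b * s * a ≡ b * (t + suc s * a)
          lem = solve-∀
          lem₂ : ∀ L a z → L * a * z ≡ L * z * a
          lem₂ = solve-∀
          lem₃ : ∀ n b s L q a → n + (b * s + L * q) * a ≡ n + (L * a * q + b * s * a)
          lem₃ = solve-∀

        high≤ : ∀ {n t x z} s → L * z ≤ b * s + L * (t / K) →
                n + L * a * z ≡ a * x + b * (K + t + s * a) → high t ≤ n
        high≤ {n} {t} {x} {z} s le eq = +-cancelʳ-≤ (L * a * q + b * s * a) _ _ (begin
          high t + (L * a * q + b * s * a)  ≡⟨ +-assoc (high t) _ _ ⟨
          high t + L * a * q + b * s * a    ≡⟨ cong (_+ b * s * a) (high-balance t) ⟩
          b * (K + t) + b * s * a           ≡⟨ lem b (K + t) s a ⟩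
          b * (K + t + s * a)               ≤⟨ m≤n+m _ (a * x) ⟩
          a * x + b * (K + t + s * a)       ≡⟨ eq ⟨
          n + L * a * z                     ≡⟨ cong (n +_) (lem₂ L a z) ⟩
          n + L * z * a                     ≤⟨ +-monoʳ-≤ n (*-monoˡ-≤ a le) ⟩
          n + (b * s + L * q) * a           ≡⟨ lem₃ n b s L q a ⟩
          n + (L * a * q + b * s * a)       ∎)
          where
          open ≤-Reasoning
          q = t / K
          lem : ∀ b t s a → b * t + b * s * a ≡ b * (t + s * a)
          lem = solve-∀
          lem₂ : ∀ L a z → L * a * z ≡ L * z * a
          lem₂ = solve-∀
          lem₃ : ∀ n b s L q a → n + (b * s + L * q) * a ≡ n + (L * a * q + b * s * a)
          lem₃ = solve-∀

        K*z≤ : ∀ {u} y z → y + K * z ≡ u → K * z ≤ u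
        K*z≤ y z refl = m≤n+m (K * z) y

        -- This is `t / K`, the greatest z compatible with s = 0, split in the same way as
        -- `threshold`.
        third : ℕ → ℕ
        third t with t <? K
        ... | yes _ = 0
        ... | no  _ = suc ((t ∸ K) / K)

        third-low : ∀ {t} → t < K → third t ≡ 0
        third-low {t} t<K with t <? K
        ... | yes _   = refl
        ... | no  t≮K = ⊥-elim (t≮K t<K)

        third-high : ∀ t → third (K + t) ≡ suc (t / K)
        third-high t with K + t <? K
        ... | yes lt = ⊥-elim (<⇒≱ lt (m≤m+n K t))
        ... | no  _  = cong (λ u → suc (u / K)) (m+n∸m≡n K t)

        K*z≤u⇒z≤u/K : ∀ z u → K * z ≤ u → z ≤ u / K
        K*z≤u⇒z≤u/K z u le = subst (_≤ u / K) (m*n/n≡m z K) (/-monoˡ-≤ K (subst (_≤ u) (*-comm K z) le))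

        -- Every other choice of s and z forces `n` up to the threshold: s ≥ 1 by the minimality
        -- hypotheses, and s = 0 with z below its maximum because less of L a z is then subtracted
        -- from b t.
        rigid : ∀ {n t x y z} s → t < a → n < threshold t → y + K * z ≡ t + s * a →
                n + L * a * z ≡ a * x + b * (t + s * a) → y + K * z ≡ t × z ≡ third t
        rigid {n} {t} {x} {y} {z} s t<a n<T e eq with view t
        rigid {n} {t} {x} {y} {z} (suc s) t<a n<T e eq | isLow t<K
          rewrite threshold-low t<K = ⊥-elim (<⇒≱ n<T (low≤ {x = x} s t<K t<a (K*z≤ y z e) eq))
        rigid {n} {t} {x} {y} {zero} zero t<a n<T e eq | isLow t<K
          rewrite third-low t<K = trans e (+-identityʳ t) , refl
        rigid {n} {t} {x} {y} {suc z} zero t<a n<T e eq | isLow t<K =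
          ⊥-elim (<⇒≱ t<K (≤-trans (m≤m*n K (suc z)) (K*z≤ y (suc z) (trans e (+-identityʳ t)))))
        rigid {n} {t} {x} {y} {z} (suc s) t<a n<T e eq | isHigh t′ refl
          rewrite threshold-high t′ =
            ⊥-elim (<⇒≱ n<T (high≤ {x = x} (suc s) (high-min t′ s z t<a (K*z≤ y z e)) eq))
        rigid {n} {t} {x} {y} {z} zero t<a n<T e eq | isHigh t′ refl
          rewrite threshold-high t′ | third-high t′ with z ≤? t′ / K
        ... | yes z≤ = ⊥-elim (<⇒≱ n<T (high≤ {x = x} 0 (≤-trans (*-monoʳ-≤ L z≤) (m≤n+m _ (b * 0))) eq))
        ... | no  z≰ = e′ , ≤-antisym
          (subst (z ≤_) [K+t]/K (K*z≤u⇒z≤u/K z (K + t′) (K*z≤ y z e′))) (≰⇒> z≰)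
          where
          e′ = trans e (+-identityʳ (K + t′))
          [K+t]/K : (K + t′) / K ≡ suc (t′ / K)
          [K+t]/K = trans (m/n≡1+[m∸n]/n (m≤m+n K t′)) (cong (λ u → suc (u / K)) (m+n∸m≡n K t′))

      below-threshold : ∀ t n → t < a → n < threshold t → Congruent a n (threshold t) → AtMostOneSolution as n
      below-threshold t n t<a n<T cg (x ∷ y ∷ z ∷ []) (x′ ∷ y′ ∷ z′ ∷ []) p p′
        with cg′ ← Congruent-trans cg (threshold≡bt t)
        with s , e , eq ← solution-shape {x = x} {y} {z} t<a cg′ p
        with s′ , e′ , eq′ ← solution-shape {x = x′} {y′} {z′} t<a cg′ p′
        with r , rz ← rigid {x = x} {y} {z} s t<a n<T e eq
        with r′ , rz′ ← rigid {x = x′} {y′} {z′} s′ t<a n<T e′ eq′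
        = solution-unique {x = x} {y} {x′} {y′} r r′ (trans rz (sym rz′)) p p′

      at-threshold : ∀ t → t < a → ¬ AtMostOneSolution as (threshold t)
      at-threshold t t<a u with view t
      -- The second solution has s = 0 and z = 0. Its first coordinate `b ∸ L * q` is what remains
      -- of `low t` after removing `b * t`, divided by `a`; `low-rep` makes the truncated
      -- subtraction exact.
      ... | isLow t<K rewrite threshold-low t<K = third≢
        (u (0 ∷ r ∷ q ∷ []) (b ∸ L * q ∷ t ∷ 0 ∷ []) (lem a b r c q)
          (+-cancelʳ-≡ (L * a * q) _ _ (begin
            a * (b ∸ L * q) + (b * t + (c * 0 + 0)) + L * a * q ≡⟨ lem₂ a (b ∸ L * q) b t c L q ⟩
            a * (b ∸ L * q + L * q) + b * t                     ≡⟨ cong (λ d → a * d + b * t) (m∸n+n≡m (low-rep t t<K t<a)) ⟩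
            a * b + b * t                                       ≡⟨ lem₃ a b t ⟩
            b * (t + a)                                         ≡⟨ low-balance t ⟨
            low t + L * a * q                                   ∎)))
        where
        open ≡-Reasoning
        q = (t + a) / K
        r = (t + a) % K
        lem : ∀ a b r c q → a * 0 + (b * r + (c * q + 0)) ≡ b * r + c * q
        lem = solve-∀
        lem₂ : ∀ a d b t c L q → a * d + (b * t + (c * 0 + 0)) + L * a * q ≡ a * (d + L * q) + b * t
        lem₂ = solve-∀
        lem₃ : ∀ a b t → a * b + b * t ≡ b * (t + a)
        lem₃ = solve-∀
        third≢ : ¬ (_≡_ {A = Vec ℕ 3} (0 ∷ r ∷ q ∷ []) (b ∸ L * q ∷ t ∷ 0 ∷ []))
        -- The quantity y + K z separates the two solutions: it is `t + a` for the first and `t` for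
        -- the second.
        third≢ eq = <⇒≢ (m<m+n t (>-nonZero⁻¹ a)) (begin
          t             ≡⟨ +-identityʳ t ⟨
          t + 0         ≡⟨ cong (t +_) (*-zeroʳ K) ⟨
          t + K * 0     ≡⟨ cong (λ { (_ ∷ y ∷ z ∷ []) → y + K * z }) eq ⟨
          r + K * q     ≡⟨ divMod (t + a) ⟩
          t + a         ∎)
      -- The relation K b = L a + c turns `K` copies of `b` in the first solution into `L` copies of
      -- `a` and one of `c` in the second.
      ... | isHigh t′ refl rewrite threshold-high t′ = third≢
        (u (0 ∷ t′ % K + K ∷ t′ / K ∷ []) (L ∷ t′ % K ∷ suc (t′ / K) ∷ [])
          (lem a b (t′ % K + K) c (t′ / K))
          (trans (lem₂ a L b (t′ % K) c (t′ / K))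
            (trans (cong (λ d → b * (t′ % K) + d + c * (t′ / K)) (sym Kb≡La+c)) (lem₃ b (t′ % K) K (c * (t′ / K))))))
        where
        lem : ∀ a b r c q → a * 0 + (b * r + (c * q + 0)) ≡ b * r + c * q
        lem = solve-∀
        lem₂ : ∀ a L b r c q → a * L + (b * r + (c * suc q + 0)) ≡ b * r + (L * a + c) + c * q
        lem₂ = solve-∀
        lem₃ : ∀ b r K z → b * r + K * b + z ≡ b * (r + K) + z
        lem₃ = solve-∀
        third≢ : ¬ (_≡_ {A = Vec ℕ 3} (0 ∷ t′ % K + K ∷ t′ / K ∷ []) (L ∷ t′ % K ∷ suc (t′ / K) ∷ []))
        third≢ eq = <⇒≢ ≤-refl (cong (λ { (_ ∷ _ ∷ z ∷ []) → z }) eq)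

      sylvester-threshold : IsSylvester 1 as (Σ< a (λ t → threshold t / a))
      sylvester-threshold = sylvester₁ a (b ∷ c ∷ []) threshold
        (λ n → let t , t<a , cg = residue n in t , t<a , Congruent-trans cg (Congruent-sym (threshold≡bt t)))
        (λ s t s<a t<a cg → cancel-< s t s<a t<a
          (Congruent-trans (Congruent-sym (threshold≡bt s)) (Congruent-trans cg (threshold≡bt t))))
        at-threshold below-threshold

  -- Finite sums and floor sums.

  private
    +-interchange : ∀ w x y z → (w + x) + (y + z) ≡ (w + y) + (x + z)
    +-interchange = solve-∀

  Σ<-cong : ∀ n {f g : ℕ → ℕ} → (∀ t → t < n → f t ≡ g t) → Σ< n f ≡ Σ< n g
  Σ<-cong zero    h = refl
  Σ<-cong (suc n) h = cong₂ _+_ (h 0 z<s) (Σ<-cong n (λ t t<n → h (suc t) (s<s t<n)))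

  Σ<-+ : ∀ n (f g : ℕ → ℕ) → Σ< n (λ t → f t + g t) ≡ Σ< n f + Σ< n g
  Σ<-+ zero    f g = refl
  Σ<-+ (suc n) f g = trans (cong (f 0 + g 0 +_) (Σ<-+ n (f ∘ suc) (g ∘ suc))) (+-interchange (f 0) (g 0) _ _)

  Σ<-* : ∀ n c (f : ℕ → ℕ) → Σ< n (λ t → c * f t) ≡ c * Σ< n f
  Σ<-* zero    c f = sym (*-zeroʳ c)
  Σ<-* (suc n) c f = trans (cong (c * f 0 +_) (Σ<-* n c (f ∘ suc))) (sym (*-distribˡ-+ c (f 0) _))

  Σ<-const : ∀ n c → Σ< n (λ _ → c) ≡ n * c
  Σ<-const zero    c = refl
  Σ<-const (suc n) c = cong (c +_) (Σ<-const n c)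

  Σ<-split : ∀ m n (f : ℕ → ℕ) → Σ< (m + n) f ≡ Σ< m f + Σ< n (f ∘ (m +_))
  Σ<-split zero    n f = refl
  Σ<-split (suc m) n f = trans (cong (f 0 +_) (Σ<-split m n (f ∘ suc))) (sym (+-assoc (f 0) _ _))

  Σ<-last : ∀ n (f : ℕ → ℕ) → Σ< (suc n) f ≡ Σ< n f + f n
  Σ<-last zero    f = +-identityʳ (f 0)
  Σ<-last (suc n) f = trans (cong (f 0 +_) (Σ<-last n (f ∘ suc))) (sym (+-assoc (f 0) _ _))

  Σ<-reverse : ∀ n (f : ℕ → ℕ) → Σ< n f ≡ Σ< n (λ t → f (n ∸ suc t))
  Σ<-reverse zero    f = refl
  Σ<-reverse (suc n) f = begin
    Σ< (suc n) f                       ≡⟨ Σ<-last n f ⟩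
    Σ< n f + f n                       ≡⟨ +-comm (Σ< n f) (f n) ⟩
    f n + Σ< n f                       ≡⟨ cong (f n +_) (Σ<-reverse n f) ⟩
    f n + Σ< n (λ t → f (n ∸ suc t))   ∎
    where open ≡-Reasoning

  [m+kn]/n≡m/n+k : ∀ m k n .{{_ : NonZero n}} → (m + k * n) / n ≡ m / n + k
  [m+kn]/n≡m/n+k m k n = trans (+-distrib-/-∣ʳ m (divides-refl k)) (cong (m / n +_) (m*n/n≡m k n))

  [n+m]/n≡1+m/n : ∀ m n .{{_ : NonZero n}} → (n + m) / n ≡ suc (m / n)
  [n+m]/n≡1+m/n m n = trans (m/n≡1+[m∸n]/n (m≤m+n n m)) (cong (λ u → suc (u / n)) (m+n∸m≡n n m))

  Σ<-/≡0 : ∀ n K .{{_ : NonZero K}} (f : ℕ → ℕ) → (∀ t → t < n → f t < K) → Σ< n (λ t → f t / K) ≡ 0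
  Σ<-/≡0 n K f h = trans (Σ<-cong n (λ t t<n → m<n⇒m/n≡0 (h t t<n))) (trans (Σ<-const n 0) (*-zeroʳ n))

  -- From `n` to `suc n` the window of `K` consecutive numerators moves by one: the term `n / K`
  -- leaves and `(K + n) / K`, larger by one, enters.
  hermite : ∀ K .{{_ : NonZero K}} n → Σ< K (λ t → (t + n) / K) ≡ n
  hermite K zero    = Σ<-/≡0 K K (_+ 0) (λ t t<K → subst (_< K) (sym (+-identityʳ t)) t<K)
  hermite K (suc n) = +-cancelʳ-≡ (n / K) _ _ (begin
    Σ< K (λ t → (t + suc n) / K) + n / K   ≡⟨ cong (_+ n / K) (Σ<-cong K (λ t _ → cong (_/ K) (+-suc t n))) ⟩
    Σ< K (λ t → suc (t + n) / K) + n / K   ≡⟨ +-comm _ (n / K) ⟩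
    Σ< (suc K) (λ t → (t + n) / K)         ≡⟨ Σ<-last K (λ t → (t + n) / K) ⟩
    Σ< K (λ t → (t + n) / K) + (K + n) / K ≡⟨ cong₂ _+_ (hermite K n) ([n+m]/n≡1+m/n n K) ⟩
    n + suc (n / K)                        ≡⟨ +-suc n (n / K) ⟩
    suc n + n / K                          ∎)
    where open ≡-Reasoning

  -- The sum is K ρ (ρ - 1) / 2 + ρ e, stated without halves or subtraction. Dropping the first
  -- block of `K` zeros lowers every remaining floor by one. Allowing `e ≡ K` admits a full last
  -- block, which occurs in (c) when F k divides F i.
  Σ<-floor : ∀ K .{{_ : NonZero K}} ρ e → e ≤ K →
             2 * Σ< (ρ * K + e) (_/ K) + K * (ρ * suc ρ) ≡ 2 * (ρ * (ρ * K + e))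
  Σ<-floor K zero    e e≤K = trans
    (cong (λ s → 2 * s + K * 0) (Σ<-/≡0 e K (λ t → t) (λ t t<e → ≤-trans t<e e≤K))) (*-zeroʳ K)
  Σ<-floor K (suc ρ) e e≤K = begin
    2 * Σ< (K + ρ * K + e) (_/ K) + K * (suc ρ * suc (suc ρ))
      ≡⟨ cong (λ s → 2 * s + K * (suc ρ * suc (suc ρ))) step ⟩
    2 * (ρ * K + e + S) + K * (suc ρ * suc (suc ρ))
      ≡⟨ lem K ρ e S ⟩
    2 * S + K * (ρ * suc ρ) + 2 * (ρ * K + e + K * suc ρ)
      ≡⟨ cong (_+ 2 * (ρ * K + e + K * suc ρ)) (Σ<-floor K ρ e e≤K) ⟩
    2 * (ρ * (ρ * K + e)) + 2 * (ρ * K + e + K * suc ρ)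
      ≡⟨ lem₂ K ρ e ⟩
    2 * (suc ρ * (K + ρ * K + e)) ∎
    where
    open ≡-Reasoning
    S = Σ< (ρ * K + e) (_/ K)
    step : Σ< (K + ρ * K + e) (_/ K) ≡ ρ * K + e + S
    step = begin
      Σ< (K + ρ * K + e) (_/ K)
        ≡⟨ cong (λ n → Σ< n (_/ K)) (+-assoc K (ρ * K) e) ⟩
      Σ< (K + (ρ * K + e)) (_/ K)
        ≡⟨ Σ<-split K (ρ * K + e) (_/ K) ⟩
      Σ< K (_/ K) + Σ< (ρ * K + e) (λ t → (K + t) / K)
        ≡⟨ cong₂ _+_ (Σ<-/≡0 K K (λ t → t) (λ t t<K → t<K)) (Σ<-cong (ρ * K + e) (λ t _ → [n+m]/n≡1+m/n t K)) ⟩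
      Σ< (ρ * K + e) (λ t → 1 + t / K)
        ≡⟨ Σ<-+ (ρ * K + e) (λ _ → 1) (_/ K) ⟩
      Σ< (ρ * K + e) (λ _ → 1) + S
        ≡⟨ cong (_+ S) (trans (Σ<-const (ρ * K + e) 1) (*-identityʳ _)) ⟩
      ρ * K + e + S ∎
    lem : ∀ K ρ e S → 2 * (ρ * K + e + S) + K * (suc ρ * suc (suc ρ))
                    ≡ 2 * S + K * (ρ * suc ρ) + 2 * (ρ * K + e + K * suc ρ)
    lem = solve-∀
    lem₂ : ∀ K ρ e → 2 * (ρ * (ρ * K + e)) + 2 * (ρ * K + e + K * suc ρ) ≡ 2 * (suc ρ * (K + ρ * K + e))
    lem₂ = solve-∀

  -- The two remainders add up to a multiple of `a` strictly between 0 and 2 a, hence to `a` itself.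
  /-complement : ∀ {x y} a .{{_ : NonZero a}} b → x + y ≡ b * a → ¬ a ∣ x → x / a + y / a + 1 ≡ b
  /-complement {x} {y} a b eq a∤x = trans (+-comm _ 1) (≤-antisym (*-cancelʳ-< a (q + q′) b lower) (s≤s⁻¹ (*-cancelʳ-< a b (2 + (q + q′)) upper)))
    where
    open ≤-Reasoning
    q = x / a
    q′ = y / a
    lem : ∀ r q r′ q′ a → (r + q * a) + (r′ + q′ * a) ≡ (r + r′) + (q + q′) * a
    lem = solve-∀
    decomposition : b * a ≡ (x % a + y % a) + (q + q′) * a
    decomposition = trans (sym eq) (trans (cong₂ _+_ (m≡m%n+[m/n]*n x a) (m≡m%n+[m/n]*n y a)) (lem (x % a) q (y % a) q′ a))
    lower : (q + q′) * a < b * a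
    lower = begin-strict
      (q + q′) * a                     <⟨ m<n+m _ (≤-trans (n≢0⇒n>0 (a∤x ∘ m%n≡0⇒n∣m x a)) (m≤m+n (x % a) (y % a))) ⟩
      (x % a + y % a) + (q + q′) * a   ≡⟨ decomposition ⟨
      b * a                            ∎
    upper : b * a < (2 + (q + q′)) * a
    upper = begin-strict
      b * a                            ≡⟨ decomposition ⟩
      (x % a + y % a) + (q + q′) * a   <⟨ +-monoˡ-< _ (+-mono-< (m%n<n x a) (m%n<n y a)) ⟩
      (a + a) + (q + q′) * a           ≡⟨ +-assoc a a _ ⟩
      (2 + (q + q′)) * a               ∎

  -- The term at 0 vanishes, and a residue t ≠ 0 is paired with its complement, where `/-complement`
  -- applies because coprimality keeps b t from being a multiple of the modulus. The modulus is
  -- `suc a` in the proof, so the partner of `suc t` is `suc (a ∸ suc t)`.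
  Σ<-floor-coprime : ∀ a .{{_ : NonZero a}} b → Coprime a b →
                     2 * Σ< a (λ t → b * t / a) + a + b ≡ a * b + 1
  Σ<-floor-coprime (suc a) b a⊥b = begin
    2 * (b * 0 / suc a + S) + suc a + b ≡⟨ cong (λ z → 2 * (z / suc a + S) + suc a + b) (*-zeroʳ b) ⟩
    2 * S + suc a + b                   ≡⟨ lem S a b ⟩
    S + S + a * 1 + (b + 1)             ≡⟨ cong (_+ (b + 1)) paired ⟩
    a * b + (b + 1)                     ≡⟨ lem₂ a b ⟩
    suc a * b + 1                       ∎
    where
    open ≡-Reasoning
    g : ℕ → ℕ
    g t = b * suc t / suc a
    S = Σ< a g
    lem : ∀ S a b → 2 * S + suc a + b ≡ S + S + a * 1 + (b + 1)
    lem = solve-∀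
    lem₂ : ∀ a b → a * b + (b + 1) ≡ suc a * b + 1
    lem₂ = solve-∀
    pair : ∀ t → t < a → g t + g (a ∸ suc t) + 1 ≡ b
    pair t t<a = /-complement (suc a) b (begin
        b * suc t + b * suc (a ∸ suc t) ≡⟨ *-distribˡ-+ b (suc t) _ ⟨
        b * (suc t + suc (a ∸ suc t))   ≡⟨ cong (b *_) (trans (+-suc (suc t) _) (cong suc (m+[n∸m]≡n t<a))) ⟩
        b * suc a                       ∎)
      (λ a∣ → <⇒≱ (s<s t<a) (∣⇒≤ (coprime-divisor {o = suc t} a⊥b a∣)))
    paired : S + S + a * 1 ≡ a * b
    paired = begin
      S + S + a * 1
        ≡⟨ cong₂ (λ s k → S + s + k) (Σ<-reverse a g) (sym (Σ<-const a 1)) ⟩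
      S + Σ< a (λ t → g (a ∸ suc t)) + Σ< a (λ _ → 1)
        ≡⟨ cong (_+ Σ< a (λ _ → 1)) (Σ<-+ a g (λ t → g (a ∸ suc t))) ⟨
      Σ< a (λ t → g t + g (a ∸ suc t)) + Σ< a (λ _ → 1)
        ≡⟨ Σ<-+ a (λ t → g t + g (a ∸ suc t)) (λ _ → 1) ⟨
      Σ< a (λ t → g t + g (a ∸ suc t) + 1)
        ≡⟨ Σ<-cong a pair ⟩
      Σ< a (λ _ → b)
        ≡⟨ Σ<-const a b ⟩
      a * b ∎

  -- Summation of the quotients of the thresholds.

  module ThresholdSum (a b c K L : ℕ) .{{_ : NonZero a}} .{{_ : NonZero K}}
    (a⊥b : Coprime a b) (Kb≡La+c : K * b ≡ L * a + c) where

    open Threshold a b c K L a⊥b Kb≡La+c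

    N = Σ< a (λ t → threshold t / a)

    private
      lem : ∀ L q a → L * q * a ≡ L * a * q
      lem = solve-∀

      -- The threshold differs from `b * t` by a multiple of `a`, so the floor passes through
      -- exactly and only ⌊b t / a⌋ is left to sum.
      threshold/a-low : ∀ t → t < K → threshold t / a + L * ((t + a) / K) ≡ b * t / a + b
      threshold/a-low t t<K = begin
        threshold t / a + L * q    ≡⟨ [m+kn]/n≡m/n+k (threshold t) (L * q) a ⟨
        (threshold t + L * q * a) / a ≡⟨ cong (_/ a) (cong₂ _+_ (threshold-low t<K) (lem L q a)) ⟩
        (low t + L * a * q) / a    ≡⟨ cong (_/ a) (trans (low-balance t) (*-distribˡ-+ b t a)) ⟩
        (b * t + b * a) / a        ≡⟨ [m+kn]/n≡m/n+k (b * t) b a ⟩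
        b * t / a + b              ∎
        where
        open ≡-Reasoning
        q = (t + a) / K

      threshold/a-high : ∀ t → threshold (K + t) / a + L * (t / K) ≡ b * (K + t) / a
      threshold/a-high t = begin
        threshold (K + t) / a + L * q    ≡⟨ [m+kn]/n≡m/n+k (threshold (K + t)) (L * q) a ⟨
        (threshold (K + t) + L * q * a) / a ≡⟨ cong (_/ a) (cong₂ _+_ (threshold-high t) (lem L q a)) ⟩
        (high t + L * a * q) / a         ≡⟨ cong (_/ a) (high-balance t) ⟩
        b * (K + t) / a                  ∎
        where
        open ≡-Reasoning
        q = t / K

      Σ<-balance : ∀ n (f w g : ℕ → ℕ) → (∀ t → t < n → f t + L * w t ≡ g t) →
                   Σ< n f + L * Σ< n w ≡ Σ< n g
      Σ<-balance n f w g h = begin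
        Σ< n f + L * Σ< n w           ≡⟨ cong (Σ< n f +_) (Σ<-* n L w) ⟨
        Σ< n f + Σ< n (λ t → L * w t) ≡⟨ Σ<-+ n f (λ t → L * w t) ⟨
        Σ< n (λ t → f t + L * w t)    ≡⟨ Σ<-cong n h ⟩
        Σ< n g                        ∎
        where open ≡-Reasoning

      Σ<-low : ∀ n → n ≤ K → Σ< n (λ t → threshold t / a) + L * Σ< n (λ t → (t + a) / K)
                           ≡ Σ< n (λ t → b * t / a) + n * b
      Σ<-low n n≤K = trans
        (Σ<-balance n _ (λ t → (t + a) / K) _ (λ t t<n → threshold/a-low t (≤-trans t<n n≤K)))
        (trans (Σ<-+ n (λ t → b * t / a) (λ _ → b)) (cong (Σ< n (λ t → b * t / a) +_) (Σ<-const n b)))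

    a≤K⇒sum : a ≤ K → 2 * N + 2 * (L * Σ< a (λ t → (t + a) / K)) + a + b ≡ 3 * (a * b) + 1
    a≤K⇒sum a≤K = begin
      2 * N + 2 * (L * W) + a + b        ≡⟨ lem₁ N (L * W) a b ⟩
      2 * (N + L * W) + a + b            ≡⟨ cong (λ s → 2 * s + a + b) (Σ<-low a a≤K) ⟩
      2 * (B + a * b) + a + b            ≡⟨ lem₂ B a b ⟩
      2 * B + a + b + 2 * (a * b)        ≡⟨ cong (_+ 2 * (a * b)) (Σ<-floor-coprime a b a⊥b) ⟩
      a * b + 1 + 2 * (a * b)            ≡⟨ lem₃ a b ⟩
      3 * (a * b) + 1                    ∎
      where
      open ≡-Reasoning
      W = Σ< a (λ t → (t + a) / K)
      B = Σ< a (λ t → b * t / a)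
      lem₁ : ∀ N w a b → 2 * N + 2 * w + a + b ≡ 2 * (N + w) + a + b
      lem₁ = solve-∀
      lem₂ : ∀ B a b → 2 * (B + a * b) + a + b ≡ 2 * B + a + b + 2 * (a * b)
      lem₂ = solve-∀
      lem₃ : ∀ a b → a * b + 1 + 2 * (a * b) ≡ 3 * (a * b) + 1
      lem₃ = solve-∀

    -- The low residues now fill the whole range below `K`, so `hermite` sums their correction to
    -- `a`; the high ones contribute a plain floor sum over the excess.
    K≤a⇒sum : ∀ d → a ≡ K + d →
      2 * N + 2 * (L * (a + Σ< d (_/ K))) + a + b ≡ a * b + 2 * (K * b) + 1
    K≤a⇒sum d a≡K+d = begin
      2 * N + 2 * (L * (a + S)) + a + b
        ≡⟨ cong (λ s → 2 * s + 2 * (L * (a + S)) + a + b) (split (λ t → threshold t / a)) ⟩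
      2 * (N₁ + N₂) + 2 * (L * (a + S)) + a + b
        ≡⟨ lem₁ N₁ N₂ L a S b ⟩
      2 * ((N₁ + L * a) + (N₂ + L * S)) + a + b
        ≡⟨ cong₂ (λ s u → 2 * (s + u) + a + b)
             (trans (cong (λ w → N₁ + L * w) (sym (hermite K a))) (Σ<-low K ≤-refl))
             (Σ<-balance d (λ t → threshold (K + t) / a) (_/ K) (λ t → b * (K + t) / a) (λ t _ → threshold/a-high t)) ⟩
      2 * ((B₁ + K * b) + B₂) + a + b
        ≡⟨ lem₂ B₁ B₂ (K * b) a b ⟩
      2 * (B₁ + B₂) + a + b + 2 * (K * b)
        ≡⟨ cong (λ s → 2 * s + a + b + 2 * (K * b)) (split (λ t → b * t / a)) ⟨
      2 * Σ< a (λ t → b * t / a) + a + b + 2 * (K * b)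
        ≡⟨ cong (_+ 2 * (K * b)) (Σ<-floor-coprime a b a⊥b) ⟩
      a * b + 1 + 2 * (K * b)
        ≡⟨ lem₃ (a * b) (2 * (K * b)) ⟩
      a * b + 2 * (K * b) + 1 ∎
      where
      open ≡-Reasoning
      split : ∀ f → Σ< a f ≡ Σ< K f + Σ< d (f ∘ (K +_))
      split f = trans (cong (λ n → Σ< n f) a≡K+d) (Σ<-split K d f)
      S = Σ< d (_/ K)
      N₁ = Σ< K (λ t → threshold t / a)
      N₂ = Σ< d (λ t → threshold (K + t) / a)
      B₁ = Σ< K (λ t → b * t / a)
      B₂ = Σ< d (λ t → b * (K + t) / a)
      lem₁ : ∀ N₁ N₂ L a S b → 2 * (N₁ + N₂) + 2 * (L * (a + S)) + a + b
                             ≡ 2 * ((N₁ + L * a) + (N₂ + L * S)) + a + b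
      lem₁ = solve-∀
      lem₂ : ∀ B₁ B₂ w a b → 2 * ((B₁ + w) + B₂) + a + b ≡ 2 * (B₁ + B₂) + a + b + 2 * w
      lem₂ = solve-∀
      lem₃ : ∀ x y → x + 1 + y ≡ x + y + 1
      lem₃ = solve-∀

  -- The inequalities behind the minimality of the thresholds.

  module Bounds (a b c K L : ℕ) .{{_ : NonZero K}} (Kb≡La+c : K * b ≡ L * a + c) where

    open ≤-Reasoning

    private
      ≤[n/K]K+K : ∀ n → n ≤ n / K * K + K
      ≤[n/K]K+K n = begin
        n                 ≡⟨ m≡m%n+[m/n]*n n K ⟩
        n % K + n / K * K ≤⟨ +-monoˡ-≤ _ (m%n≤n n K) ⟩
        K + n / K * K     ≡⟨ +-comm K _ ⟩
        n / K * K + K     ∎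

      K[Lz] : ∀ z → K * (L * z) ≡ L * (K * z)
      K[Lz] z = lem K L z
        where
        lem : ∀ K L z → K * (L * z) ≡ L * (K * z)
        lem = solve-∀

      Kbs : ∀ s q → K * (b * s + L * q) ≡ (L * a + c) * s + K * (L * q)
      Kbs s q = trans (lem K b s (L * q)) (cong (λ e → e * s + K * (L * q)) Kb≡La+c)
        where
        lem : ∀ K b s w → K * (b * s + w) ≡ K * b * s + K * w
        lem = solve-∀

      min₀ : ∀ n z → K * z ≤ n + 0 → L * z ≤ b * 0 + L * (n / K)
      min₀ n z le = begin
        L * z               ≤⟨ *-monoʳ-≤ L (subst (_≤ n / K) (m*n/n≡m z K)
                                 (/-monoˡ-≤ K (subst₂ _≤_ (*-comm K z) (+-identityʳ n) le))) ⟩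
        L * (n / K)         ≤⟨ m≤n+m _ (b * 0) ⟩
        b * 0 + L * (n / K) ∎


    module _ (LK≤c : L * K ≤ c) where

      -- After scaling by `K`, replacing `t + a` by the next multiple of `K` loses at most `L * K`,
      -- while each further multiple of `a` gains K b - L a = c. One gain pays for the loss; with no
      -- further multiple, `z` is at most the quotient anyway.
      low-min : ∀ t s z → K * z ≤ t + a + s * a → L * z ≤ b * s + L * ((t + a) / K)
      low-min t zero    z le = min₀ (t + a) z le
      low-min t (suc s) z le = *-cancelˡ-≤ K (begin
        K * (L * z)                                ≡⟨ K[Lz] z ⟩
        L * (K * z)                                ≤⟨ *-monoʳ-≤ L (≤-trans le (+-monoˡ-≤ _ (≤[n/K]K+K (t + a)))) ⟩
        L * (q * K + K + suc s * a)                ≡⟨ lem L q K s a ⟩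
        L * a * suc s + L * K + K * (L * q)        ≤⟨ +-monoˡ-≤ _ (+-monoʳ-≤ (L * a * suc s) (≤-trans LK≤c (m≤m*n c (suc s)))) ⟩
        L * a * suc s + c * suc s + K * (L * q)    ≡⟨ cong (_+ K * (L * q)) (*-distribʳ-+ (suc s) (L * a) c) ⟨
        (L * a + c) * suc s + K * (L * q)          ≡⟨ Kbs (suc s) q ⟨
        K * (b * suc s + L * q)                    ∎)
        where
        q = (t + a) / K
        lem : ∀ L q K s a → L * (q * K + K + suc s * a) ≡ L * a * suc s + L * K + K * (L * q)
        lem = solve-∀

      low-rep : ∀ t → t < K → L * ((t + a) / K) ≤ b
      low-rep t t<K = *-cancelˡ-≤ K (begin
        K * (L * ((t + a) / K)) ≡⟨ lem K L ((t + a) / K) ⟩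
        L * ((t + a) / K * K)   ≤⟨ *-monoʳ-≤ L (m/n*n≤m (t + a) K) ⟩
        L * (t + a)             ≤⟨ *-monoʳ-≤ L (+-monoˡ-≤ a (<⇒≤ t<K)) ⟩
        L * (K + a)             ≡⟨ *-distribˡ-+ L K a ⟩
        L * K + L * a           ≤⟨ +-monoˡ-≤ (L * a) LK≤c ⟩
        c + L * a               ≡⟨ +-comm c _ ⟩
        L * a + c               ≡⟨ Kb≡La+c ⟨
        K * b                   ∎)
        where
        lem : ∀ K L q → K * (L * q) ≡ L * (q * K)
        lem = solve-∀

    -- The estimate is that of `low-min`, but z is compared with `t / K` while the residue is
    -- `K + t`, so the loss is two blocks of `K`.
    high-min : 2 * (L * K) ≤ c →
               ∀ t s z → K * z ≤ K + t + suc s * a → L * z ≤ b * suc s + L * (t / K)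
    high-min 2LK≤c t s z le = *-cancelˡ-≤ K (begin
      K * (L * z)                                   ≡⟨ K[Lz] z ⟩
      L * (K * z)                                   ≤⟨ *-monoʳ-≤ L (≤-trans le (+-monoˡ-≤ _ (+-monoʳ-≤ K (≤[n/K]K+K t)))) ⟩
      L * (K + (q * K + K) + suc s * a)             ≡⟨ lem L q K s a ⟩
      L * a * suc s + 2 * (L * K) + K * (L * q)     ≤⟨ +-monoˡ-≤ _ (+-monoʳ-≤ (L * a * suc s) (≤-trans 2LK≤c (m≤m*n c (suc s)))) ⟩
      L * a * suc s + c * suc s + K * (L * q)       ≡⟨ cong (_+ K * (L * q)) (*-distribʳ-+ (suc s) (L * a) c) ⟨
      (L * a + c) * suc s + K * (L * q)             ≡⟨ Kbs (suc s) q ⟨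
      K * (b * suc s + L * q)                       ∎)
      where
      q = t / K
      lem : ∀ L q K s a → L * (K + (q * K + K) + suc s * a) ≡ L * a * suc s + 2 * (L * K) + K * (L * q)
      lem = solve-∀

    -- No rounding to multiples of `K` is made. For `suc s`, the condition `t < a` gives K L z ≤ (s
    -- + 3) L a ≤ 3 (s + 1) L a, which the hypothesis bounds by K b (s + 1).
    low-min′ : 3 * (L * a) ≤ K * b → ∀ t s z → t < a → K * z ≤ t + a + s * a → L * z ≤ b * s + L * ((t + a) / K)
    low-min′ 3La≤Kb t zero    z t<a le = min₀ (t + a) z le
    low-min′ 3La≤Kb t (suc s) z t<a le = ≤-trans (*-cancelˡ-≤ K (begin
      K * (L * z)                                   ≡⟨ K[Lz] z ⟩
      L * (K * z)                                   ≤⟨ *-monoʳ-≤ L (≤-trans le (+-monoˡ-≤ _ (+-monoˡ-≤ a (<⇒≤ t<a)))) ⟩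
      L * (a + a + suc s * a)                       ≤⟨ m≤m+n _ (2 * s * (L * a)) ⟩
      L * (a + a + suc s * a) + 2 * s * (L * a)     ≡⟨ lem L a s ⟩
      3 * (L * a) * suc s                           ≤⟨ *-monoˡ-≤ (suc s) 3La≤Kb ⟩
      K * b * suc s                                 ≡⟨ *-assoc K b (suc s) ⟩
      K * (b * suc s)                               ∎)) (m≤m+n _ _)
      where
      lem : ∀ L a s → L * (a + a + suc s * a) + 2 * s * (L * a) ≡ 3 * (L * a) * suc s
      lem = solve-∀

  -- Fibonacci identities and the three ranges of k.

  F-+ : ∀ m n → F (m + suc n) ≡ F (suc m) * F (suc n) + F m * F n
  F-+ zero          n = sym (trans (+-identityʳ _) (*-identityˡ _))
  F-+ (suc zero)    n = sym (cong₂ _+_ (*-identityˡ (F (suc n))) (*-identityˡ (F n)))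
  F-+ (suc (suc m)) n = trans (cong₂ _+_ (F-+ (suc m) n) (F-+ m n)) (lem (F (suc m)) (F m) (F (suc n)) (F n))
    where
    lem : ∀ x y u v → ((x + y) * u + x * v) + (x * u + y * v) ≡ ((x + y) + x) * u + (x + y) * v
    lem = solve-∀

  F-suc-mono : ∀ n → F n ≤ F (suc n)
  F-suc-mono zero    = z≤n
  F-suc-mono (suc n) = m≤m+n (F (suc n)) (F n)

  F-mono : ∀ {m n} → m ≤ n → F m ≤ F n
  F-mono {m} m≤n with d , refl ← m≤n⇒∃[o]m+o≡n m≤n = go d
    where
    go : ∀ d → F m ≤ F (m + d)
    go zero    = ≤-reflexive (cong F (sym (+-identityʳ m)))
    go (suc d) = ≤-trans (go d) (≤-trans (F-suc-mono (m + d)) (≤-reflexive (cong F (sym (+-suc m d)))))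

  2F≤F : ∀ n → 2 * F n ≤ F (2 + n)
  2F≤F n = +-mono-≤ (F-suc-mono n) (≤-reflexive (+-identityʳ (F n)))

  F-coprime : ∀ n → Coprime (F n) (F (suc n))
  F-coprime zero    (_ , d∣1) = ∣1⇒≡1 d∣1
  F-coprime (suc n) (p , q) = F-coprime n (∣m+n∣m⇒∣n q p , p)

  F-coprime₂ : ∀ n → Coprime (F n) (F (2 + n))
  F-coprime₂ n {d} (p , q) = F-coprime n (p , ∣m+n∣m⇒∣n (subst (d ∣_) (+-comm (F (suc n)) (F n)) q) p)

  -- This is the relation c = K b - L a; expanding F (2 + k) and F (2 + i) once reduces it to the
  -- addition formula.
  F-relation : ∀ i k → F (2 + k) * F (2 + i) ≡ F k * F i + F (i + (2 + k))
  F-relation i k = trans (lem (F (suc k)) (F k) (F (suc i)) (F i)) (cong (F k * F i +_) (sym (F-+ i (suc k))))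
    where
    lem : ∀ x y u v → (x + y) * (u + v) ≡ y * v + (u * (x + y) + v * x)
    lem = solve-∀

  F-product : ∀ i k → F (suc i) * F (suc k) ≤ F (i + suc k)
  F-product i k = ≤-trans (m≤m+n _ _) (≤-reflexive (sym (F-+ i k)))

  -- Since F 1 = F 2, `F` is only weakly increasing, but a strict inequality between values still
  -- reflects to the indices.
  <F⇒< : ∀ {m n} → F m < F n → m < n
  <F⇒< {m} {n} lt with n ≤? m
  ... | yes n≤m = ⊥-elim (<⇒≱ lt (F-mono n≤m))
  ... | no  n≰m = ≰⇒> n≰m

  -- The k of the theorem is 2 + k here, so that F (k ∸ 2) becomes F k.
  module Generators (i k : ℕ) (i≥3 : 3 ≤ i) where

    private
      a = F i
      b = F (2 + i)
      K = F (2 + k)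
      L = F k
      c = F (i + (2 + k))

      instance
        a≢0 : NonZero a
        a≢0 = F-nonZero i≥3
        K≢0 : NonZero K
        K≢0 = >-nonZero (1≤F-suc (suc k))

    open Threshold a b c K L (F-coprime₂ i) (F-relation i k)
    open ThresholdSum a b c K L (F-coprime₂ i) (F-relation i k)
    open Bounds a b c K L (F-relation i k)

    -- Here 2 a ≤ K, so every ⌊(t+a)/K⌋ with t < a is 0 and the correction disappears. No residue is
    -- high, which makes the third hypothesis vacuous.
    large : i ≤ k → ∃[ N ] IsSylvester 1 as N × 2 * N + a + b ≡ 3 * (a * b) + 1
    large i≤k = N ,
      sylvester-threshold
        (λ t s z _ t<a → low-min′ 3La≤Kb t s z t<a)
        (λ t _ t<a → subst (λ q → L * q ≤ b) (sym (m<n⇒m/n≡0 (t+a<K t t<a))) (≤-trans (≤-reflexive (*-zeroʳ L)) z≤n))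
        (λ t s z K+t<a _ → ⊥-elim (<⇒≱ (≤-<-trans (m≤m+n K t) K+t<a) a≤K)) ,
      trans (sym (lem N (Σ<-/≡0 a K (_+ a) t+a<K))) (a≤K⇒sum a≤K)
      where
      2a≤K : 2 * a ≤ K
      2a≤K = ≤-trans (2F≤F i) (F-mono (+-monoʳ-≤ 2 i≤k))
      a≤K : a ≤ K
      a≤K = ≤-trans (m≤m+n a _) 2a≤K
      t+a<K : ∀ t → t < a → t + a < K
      t+a<K t t<a = <-≤-trans (+-monoˡ-< a t<a) (subst (λ d → a + d ≤ K) (+-identityʳ a) 2a≤K)
      3La≤Kb : 3 * (L * a) ≤ K * b
      3La≤Kb = ≤-trans (m≤m+n _ (L * a)) (≤-trans (≤-reflexive (lem₂ L a)) (*-mono-≤ (2F≤F k) (2F≤F i)))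
        where
        lem₂ : ∀ L a → 3 * (L * a) + L * a ≡ (2 * L) * (2 * a)
        lem₂ = solve-∀
      lem : ∀ N {w} → w ≡ 0 → 2 * N + 2 * (L * w) + a + b ≡ 2 * N + a + b
      lem N refl = cong (λ z → z + a + b) (trans (cong (λ z → 2 * N + 2 * z) (*-zeroʳ L)) (+-identityʳ (2 * N)))

    -- For t < a the floor ⌊(t+a)/K⌋ is 0 when t < e and 1 for the remaining `d` residues, so the
    -- correction is L d with d = 2 a - K.
    medium : ∀ e d → a ≡ e + d → K ≡ a + e → k ≤ suc i →
      ∃[ N ] IsSylvester 1 as N × 2 * N + 2 * (L * d) + a + b ≡ 3 * (a * b) + 1
    medium e d a≡e+d K≡a+e k≤1+i = N ,
      sylvester-threshold
        (λ t s z _ _ → low-min LK≤c t s z)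
        (λ t t<K _ → low-rep LK≤c t t<K)
        (λ t s z K+t<a _ → ⊥-elim (<⇒≱ (≤-<-trans (m≤m+n K t) K+t<a) a≤K)) ,
      trans (cong (λ w → 2 * N + 2 * (L * w) + a + b) (sym sum-d)) (a≤K⇒sum a≤K)
      where
      a≤K : a ≤ K
      a≤K = subst (a ≤_) (sym K≡a+e) (m≤m+n a e)
      LK≤c : L * K ≤ c
      LK≤c = ≤-trans (*-monoˡ-≤ K (F-mono k≤1+i)) (F-product i (suc k))
      t+d<K : ∀ t → t < d → t < K
      t+d<K t t<d = <-≤-trans t<d (≤-trans (subst (d ≤_) (sym a≡e+d) (m≤n+m d e)) a≤K)
      one : ∀ t → t < d → (e + t + a) / K ≡ 1
      one t t<d = trans (cong (_/ K) (trans (lem e t a) (cong (_+ t) (sym K≡a+e))))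
        (trans ([n+m]/n≡1+m/n t K) (cong suc (m<n⇒m/n≡0 (t+d<K t t<d))))
        where
        lem : ∀ e t a → e + t + a ≡ a + e + t
        lem = solve-∀
      sum-d : Σ< a (λ t → (t + a) / K) ≡ d
      sum-d = begin
        Σ< a (λ t → (t + a) / K)                                     ≡⟨ cong (λ n → Σ< n (λ t → (t + a) / K)) a≡e+d ⟩
        Σ< (e + d) (λ t → (t + a) / K)                               ≡⟨ Σ<-split e d (λ t → (t + a) / K) ⟩
        Σ< e (λ t → (t + a) / K) + Σ< d (λ t → (e + t + a) / K)
          ≡⟨ cong₂ _+_ (Σ<-/≡0 e K (_+ a) (λ t t<e → subst (t + a <_) (trans (+-comm e a) (sym K≡a+e)) (+-monoˡ-< a t<e)))
                       (Σ<-cong d one) ⟩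
        Σ< d (λ _ → 1)                                               ≡⟨ trans (Σ<-const d 1) (*-identityʳ d) ⟩
        d ∎
        where open ≡-Reasoning

    -- The r of the theorem is `suc ρ`, and `ρ * K + e` = a - K is the number of high residues.
    small : 2 + k < i → ∀ ρ e → e ≤ K → a ≡ K + (ρ * K + e) →
      ∃[ N ] ∃[ S ] IsSylvester 1 as N ×
        2 * N + 2 * (L * (a + S)) + a + b ≡ a * b + 2 * (K * b) + 1 ×
        2 * S + K * (ρ * suc ρ) ≡ 2 * (ρ * (ρ * K + e))
    small k+2<i ρ e e≤K a≡ = N , Σ< (ρ * K + e) (_/ K) ,
      sylvester-threshold
        (λ t s z _ _ → low-min LK≤c t s z)
        (λ t t<K _ → low-rep LK≤c t t<K)
        (λ t s z _ → high-min 2LK≤c t s z) ,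
      K≤a⇒sum (ρ * K + e) a≡ , Σ<-floor K ρ e e≤K
      where
      2LK≤c : 2 * (L * K) ≤ c
      2LK≤c = ≤-trans (≤-reflexive (sym (*-assoc 2 L K)))
        (≤-trans (*-monoˡ-≤ K (≤-trans (2F≤F k) (F-mono (≤-trans (<⇒≤ k+2<i) (n≤1+n i))))) (F-product i (suc k)))
      LK≤c : L * K ≤ c
      LK≤c = ≤-trans (m≤m+n _ _) 2LK≤c

  1≤[Fi∸1]/Fk⇔ : ∀ i k .{{_ : NonZero (F k)}} → 3 ≤ i → 1 ≤ (F i ∸ 1) / F k ⇔ k ≤ i ∸ 1
  1≤[Fi∸1]/Fk⇔ (suc (suc (suc i))) k (s≤s (s≤s (s≤s _))) = mk⇔
    (λ 1≤r → s≤s⁻¹ (<F⇒< (F<F (m/n≢0⇒n≤m (n>0⇒n≢0 1≤r)))))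
    -- The gap between consecutive values F (i - 1) and F i is F (i - 2), which is at least 1
    -- because i ≥ 3.
    (λ k≤ → m≥n⇒m/n>0 (≤-trans (F-mono k≤) (pred-mono-≤ (subst (_≤ F (3 + i)) (+-comm _ 1) (+-monoʳ-≤ (F (2 + i)) (1≤F-suc i))))))
    where
    F<F : F k ≤ F (3 + i) ∸ 1 → F k < F (3 + i)
    F<F le = ≤-trans (s≤s le) (≤-reflexive (m+[n∸m]≡n (1≤F-suc (2 + i))))

open NaturalNumbers using (module Generators; 1≤[Fi∸1]/Fk⇔)

open import Data.Integer.Base as ℤ using (+_)
import Data.Integer.Properties as ℤ
open import Data.Rational.Base using (ℚ; ½; _+_; _-_; _*_; 1ℚ)
open import Data.Rational.Properties using (toℚᵘ-injective; toℚᵘ-homo-+; toℚᵘ-homo-*)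
open import Data.Rational.Solver using (module +-*-Solver)
import Data.Rational.Unnormalised.Base as ℚᵘ
import Data.Rational.Unnormalised.Properties as ℚᵘ

-- Passage from natural-number equations to rational formulas.

fromℕ-+ : ∀ m n → fromℕ (m ℕ.+ n) ≡ fromℕ m + fromℕ n
fromℕ-+ m n = toℚᵘ-injective (ℚᵘ.≃-trans
  (ℚᵘ.*≡* (cong (ℤ._* (+ 1)) (cong₂ ℤ._+_ (sym (ℤ.*-identityʳ (+ m))) (sym (ℤ.*-identityʳ (+ n))))))
  (ℚᵘ.≃-sym (toℚᵘ-homo-+ (fromℕ m) (fromℕ n))))

fromℕ-* : ∀ m n → fromℕ (m ℕ.* n) ≡ fromℕ m * fromℕ n
fromℕ-* m n = toℚᵘ-injective (ℚᵘ.≃-trans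
  (ℚᵘ.*≡* (cong (ℤ._* (+ 1)) (ℤ.pos-* m n)))
  (ℚᵘ.≃-sym (toℚᵘ-homo-* (fromℕ m) (fromℕ n))))

private
  2ℚ = fromℕ 2
  3ℚ = fromℕ 3

-- `lem₁` writes `N` around the left side of `eq`, so that the hypothesis enters by `cong` between
-- two ring identities. The other two cases follow the same pattern.
large-solve : ∀ N a b → 2ℚ * N + a + b ≡ 3ℚ * (a * b) + 1ℚ → N ≡ ½ * (3ℚ * a * b - a - b + 1ℚ)
large-solve N a b eq = begin
  N                                     ≡⟨ lem₁ N a b ⟩
  ½ * (2ℚ * N + a + b - a - b)          ≡⟨ cong (λ x → ½ * (x - a - b)) eq ⟩
  ½ * (3ℚ * (a * b) + 1ℚ - a - b)       ≡⟨ lem₂ a b ⟩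
  ½ * (3ℚ * a * b - a - b + 1ℚ)         ∎
  where
  open ≡-Reasoning
  open +-*-Solver
  lem₁ : ∀ N a b → N ≡ ½ * (2ℚ * N + a + b - a - b)
  lem₁ = solve 3 (λ N a b → N := con ½ :* (con 2ℚ :* N :+ a :+ b :- a :- b)) refl
  lem₂ : ∀ a b → ½ * (3ℚ * (a * b) + 1ℚ - a - b) ≡ ½ * (3ℚ * a * b - a - b + 1ℚ)
  lem₂ = solve 2 (λ a b → con ½ :* (con 3ℚ :* (a :* b) :+ con 1ℚ :- a :- b)
                       := con ½ :* (con 3ℚ :* a :* b :- a :- b :+ con 1ℚ)) refl

medium-solve : ∀ N a b K L d → d + K ≡ 2ℚ * a →
  2ℚ * N + 2ℚ * (L * d) + a + b ≡ 3ℚ * (a * b) + 1ℚ →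
  N ≡ ½ * (3ℚ * a * b - a - b + 1ℚ) - (2ℚ * a - K) * L
medium-solve N a b K L d eq₁ eq = begin
  N
    ≡⟨ lem₁ N a b K L d ⟩
  ½ * (2ℚ * N + 2ℚ * (L * d) + a + b - a - b) - (d + K - K) * L
    ≡⟨ cong₂ (λ x y → ½ * (x - a - b) - (y - K) * L) eq eq₁ ⟩
  ½ * (3ℚ * (a * b) + 1ℚ - a - b) - (2ℚ * a - K) * L
    ≡⟨ lem₂ a b ((2ℚ * a - K) * L) ⟩
  ½ * (3ℚ * a * b - a - b + 1ℚ) - (2ℚ * a - K) * L ∎
  where
  open ≡-Reasoning
  open +-*-Solver
  lem₁ : ∀ N a b K L d → N ≡ ½ * (2ℚ * N + 2ℚ * (L * d) + a + b - a - b) - (d + K - K) * L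
  lem₁ = solve 6 (λ N a b K L d → N :=
    con ½ :* (con 2ℚ :* N :+ con 2ℚ :* (L :* d) :+ a :+ b :- a :- b) :- (d :+ K :- K) :* L) refl
  lem₂ : ∀ a b w → ½ * (3ℚ * (a * b) + 1ℚ - a - b) - w ≡ ½ * (3ℚ * a * b - a - b + 1ℚ) - w
  lem₂ = solve 3 (λ a b w → con ½ :* (con 3ℚ :* (a :* b) :+ con 1ℚ :- a :- b) :- w
                         := con ½ :* (con 3ℚ :* a :* b :- a :- b :+ con 1ℚ) :- w) refl

small-solve : ∀ N S a b K L d ρ r → a ≡ K + d → r ≡ 1ℚ + ρ →
  2ℚ * N + 2ℚ * (L * (a + S)) + a + b ≡ a * b + 2ℚ * (K * b) + 1ℚ →
  2ℚ * S + K * (ρ * (1ℚ + ρ)) ≡ 2ℚ * (ρ * d) →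
  N ≡ ½ * ((a + 2ℚ * K - 1ℚ) * b - a + 1ℚ) - (r * a - ½ * ((r - 1ℚ) * (r + 2ℚ)) * K) * L
small-solve N S a b K L d ρ r refl refl eq eq₁ = begin
  N
    ≡⟨ lem₁ N S (K + d) b K L ρ ⟩
  -- The term `K * (ρ * (1ℚ + ρ))` is added and subtracted so that the left side of `eq₁` appears
  -- and `S` can be eliminated.
  ½ * (2ℚ * N + 2ℚ * (L * (K + d + S)) + (K + d) + b - (K + d) - b - 2ℚ * (L * (K + d))
       - L * (2ℚ * S + K * (ρ * (1ℚ + ρ)) - K * (ρ * (1ℚ + ρ))))
    ≡⟨ cong₂ (λ x y → ½ * (x - (K + d) - b - 2ℚ * (L * (K + d)) - L * (y - K * (ρ * (1ℚ + ρ))))) eq eq₁ ⟩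
  ½ * ((K + d) * b + 2ℚ * (K * b) + 1ℚ - (K + d) - b - 2ℚ * (L * (K + d))
       - L * (2ℚ * (ρ * d) - K * (ρ * (1ℚ + ρ))))
    ≡⟨ lem₂ b K L d ρ ⟩
  ½ * ((K + d + 2ℚ * K - 1ℚ) * b - (K + d) + 1ℚ)
    - ((1ℚ + ρ) * (K + d) - ½ * ((1ℚ + ρ - 1ℚ) * (1ℚ + ρ + 2ℚ)) * K) * L ∎
  where
  open ≡-Reasoning
  open +-*-Solver
  lem₁ : ∀ N S a b K L ρ → N ≡
    ½ * (2ℚ * N + 2ℚ * (L * (a + S)) + a + b - a - b - 2ℚ * (L * a)
         - L * (2ℚ * S + K * (ρ * (1ℚ + ρ)) - K * (ρ * (1ℚ + ρ))))
  lem₁ = solve 7 (λ N S a b K L ρ → N :=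
    con ½ :* (con 2ℚ :* N :+ con 2ℚ :* (L :* (a :+ S)) :+ a :+ b :- a :- b :- con 2ℚ :* (L :* a)
         :- L :* (con 2ℚ :* S :+ K :* (ρ :* (con 1ℚ :+ ρ)) :- K :* (ρ :* (con 1ℚ :+ ρ))))) refl
  lem₂ : ∀ b K L d ρ →
    ½ * ((K + d) * b + 2ℚ * (K * b) + 1ℚ - (K + d) - b - 2ℚ * (L * (K + d))
         - L * (2ℚ * (ρ * d) - K * (ρ * (1ℚ + ρ)))) ≡
    ½ * ((K + d + 2ℚ * K - 1ℚ) * b - (K + d) + 1ℚ)
      - ((1ℚ + ρ) * (K + d) - ½ * ((1ℚ + ρ - 1ℚ) * (1ℚ + ρ + 2ℚ)) * K) * L
  lem₂ = solve 5 (λ b K L d ρ →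
    con ½ :* ((K :+ d) :* b :+ con 2ℚ :* (K :* b) :+ con 1ℚ :- (K :+ d) :- b :- con 2ℚ :* (L :* (K :+ d))
         :- L :* (con 2ℚ :* (ρ :* d) :- K :* (ρ :* (con 1ℚ :+ ρ)))) :=
    con ½ :* ((K :+ d :+ con 2ℚ :* K :- con 1ℚ) :* b :- (K :+ d) :+ con 1ℚ)
      :- ((con 1ℚ :+ ρ) :* (K :+ d) :- con ½ :* ((con 1ℚ :+ ρ :- con 1ℚ) :* (con 1ℚ :+ ρ :+ con 2ℚ)) :* K) :* L) refl

private
  infixl 7 _⟨*⟩_
  infixl 6 _⟨+⟩_

  -- The image of a natural-number expression is built operation by operation; as a record, the
  -- relation keeps both indices visible to unification.
  record _↝_ (n : ℕ) (q : ℚ) : Set where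
    constructor ⟨_⟩
    field fromℕ≡ : fromℕ n ≡ q

  lit : ∀ n → n ↝ fromℕ n
  lit n = ⟨ refl ⟩

  _⟨+⟩_ : ∀ {m n p q} → m ↝ p → n ↝ q → (m ℕ.+ n) ↝ (p + q)
  _⟨+⟩_ {m} {n} ⟨ e ⟩ ⟨ f ⟩ = ⟨ trans (fromℕ-+ m n) (cong₂ _+_ e f) ⟩

  _⟨*⟩_ : ∀ {m n p q} → m ↝ p → n ↝ q → (m ℕ.* n) ↝ (p * q)
  _⟨*⟩_ {m} {n} ⟨ e ⟩ ⟨ f ⟩ = ⟨ trans (fromℕ-* m n) (cong₂ _*_ e f) ⟩

  transport : ∀ {m n p q} → m ↝ p → n ↝ q → m ≡ n → p ≡ q
  transport ⟨ e ⟩ ⟨ f ⟩ refl = trans (sym e) f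

large-cast : ∀ N a b → 2 ℕ.* N ℕ.+ a ℕ.+ b ≡ 3 ℕ.* (a ℕ.* b) ℕ.+ 1 →
  let a′ = fromℕ a; b′ = fromℕ b in
  fromℕ N ≡ ½ * (fromℕ 3 * a′ * b′ - a′ - b′ + 1ℚ)
large-cast N a b eq = large-solve (fromℕ N) (fromℕ a) (fromℕ b)
  (transport (lit 2 ⟨*⟩ lit N ⟨+⟩ lit a ⟨+⟩ lit b) (lit 3 ⟨*⟩ (lit a ⟨*⟩ lit b) ⟨+⟩ lit 1) eq)

medium-cast : ∀ N a b K L d → d ℕ.+ K ≡ 2 ℕ.* a →
  2 ℕ.* N ℕ.+ 2 ℕ.* (L ℕ.* d) ℕ.+ a ℕ.+ b ≡ 3 ℕ.* (a ℕ.* b) ℕ.+ 1 →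
  let a′ = fromℕ a; b′ = fromℕ b in
  fromℕ N ≡ ½ * (fromℕ 3 * a′ * b′ - a′ - b′ + 1ℚ) - (fromℕ 2 * a′ - fromℕ K) * fromℕ L
medium-cast N a b K L d eq₁ eq =
  medium-solve (fromℕ N) (fromℕ a) (fromℕ b) (fromℕ K) (fromℕ L) (fromℕ d)
    (transport (lit d ⟨+⟩ lit K) (lit 2 ⟨*⟩ lit a) eq₁)
    (transport (lit 2 ⟨*⟩ lit N ⟨+⟩ lit 2 ⟨*⟩ (lit L ⟨*⟩ lit d) ⟨+⟩ lit a ⟨+⟩ lit b)
               (lit 3 ⟨*⟩ (lit a ⟨*⟩ lit b) ⟨+⟩ lit 1) eq)

small-cast : ∀ N S a b K L d ρ → a ≡ K ℕ.+ d →
  2 ℕ.* N ℕ.+ 2 ℕ.* (L ℕ.* (a ℕ.+ S)) ℕ.+ a ℕ.+ b ≡ a ℕ.* b ℕ.+ 2 ℕ.* (K ℕ.* b) ℕ.+ 1 →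
  2 ℕ.* S ℕ.+ K ℕ.* (ρ ℕ.* suc ρ) ≡ 2 ℕ.* (ρ ℕ.* d) →
  let a′ = fromℕ a; b′ = fromℕ b; K′ = fromℕ K; r′ = fromℕ (suc ρ) in
  fromℕ N ≡ ½ * ((a′ + fromℕ 2 * K′ - 1ℚ) * b′ - a′ + 1ℚ)
            - (r′ * a′ - ½ * ((r′ - 1ℚ) * (r′ + fromℕ 2)) * K′) * fromℕ L
small-cast N S a b K L d ρ a≡K+d eq eq₁ =
  small-solve (fromℕ N) (fromℕ S) (fromℕ a) (fromℕ b) (fromℕ K) (fromℕ L) (fromℕ d) (fromℕ ρ) (fromℕ (suc ρ))
    (transport (lit a) (lit K ⟨+⟩ lit d) a≡K+d)
    (fromℕ-+ 1 ρ)
    (transport (lit 2 ⟨*⟩ lit N ⟨+⟩ lit 2 ⟨*⟩ (lit L ⟨*⟩ (lit a ⟨+⟩ lit S)) ⟨+⟩ lit a ⟨+⟩ lit b)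
               (lit a ⟨*⟩ lit b ⟨+⟩ lit 2 ⟨*⟩ (lit K ⟨*⟩ lit b) ⟨+⟩ lit 1) eq)
    (transport (lit 2 ⟨*⟩ lit S ⟨+⟩ lit K ⟨*⟩ (lit ρ ⟨*⟩ (lit 1 ⟨+⟩ lit ρ)))
               (lit 2 ⟨*⟩ (lit ρ ⟨*⟩ lit d)) eq₁)

-- For `k` = i in the theorem, e = 0 and d = F i; for i + 1, e = F (i - 1) and d = F (i - 2).
differences : ∀ i k → 3 ≤ 2 ℕ.+ k → 2 ℕ.+ k ≡ i ⊎ 2 ℕ.+ k ≡ suc i →
  ∃[ e ] ∃[ d ] F i ≡ e ℕ.+ d × F (2 ℕ.+ k) ≡ F i ℕ.+ e × k ≤ suc i
differences i k       _ (inj₁ refl) = 0 , F i , refl , sym (ℕ.+-identityʳ (F i)) , ℕ.m≤n+m k 3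
differences i (suc j) _ (inj₂ refl) = F (suc j) , F j , refl , refl , ℕ.m≤n+m (suc j) 2
differences i zero    (s≤s (s≤s ())) (inj₂ refl)

theorem10 : (i k : ℕ) (i≥3 : 3 ≤ i) (k≥3 : 3 ≤ k) →
  let Fᵢ   = fromℕ (F i)
      Fᵢ₊₂ = fromℕ (F (i ℕ.+ 2))
      Fₖ   = fromℕ (F k)
      Fₖ₋₂ = fromℕ (F (k ∸ 2))
      n₁≡  = λ q → ∃[ N ] IsSylvester 1 (F i ∷ F (i ℕ.+ 2) ∷ F (i ℕ.+ k) ∷ []) N × fromℕ N ≡ q
      r    = ℕ._/_ (F i ∸ 1) (F k) {{F-nonZero k≥3}}
  in
    (i ℕ.+ 2 ≤ k →
      n₁≡ (½ * (fromℕ 3 * Fᵢ * Fᵢ₊₂ - Fᵢ - Fᵢ₊₂ + 1ℚ)))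
  × (k ≡ i ⊎ k ≡ i ℕ.+ 1 →
      n₁≡ (½ * (fromℕ 3 * Fᵢ * Fᵢ₊₂ - Fᵢ - Fᵢ₊₂ + 1ℚ) - (fromℕ 2 * Fᵢ - Fₖ) * Fₖ₋₂))
  × (1 ≤ r ⇔ k ≤ i ∸ 1)
  × (1 ≤ r →
      n₁≡ (½ * ((Fᵢ + fromℕ 2 * Fₖ - 1ℚ) * Fᵢ₊₂ - Fᵢ + 1ℚ)
           - (fromℕ r * Fᵢ - ½ * ((fromℕ r - 1ℚ) * (fromℕ r + fromℕ 2)) * Fₖ) * Fₖ₋₂))
theorem10 i (suc (suc k)) i≥3 k≥3 rewrite ℕ.+-comm i 2 | ℕ.+-comm i 1 =
  (λ i+2≤k → let N , syl , eq = large (s≤s⁻¹ (s≤s⁻¹ i+2≤k)) in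
    N , syl , large-cast N (F i) (F (2 ℕ.+ i)) eq) ,
  (λ k≡ → let e , d , a≡ , K≡ , k≤ = differences i k k≥3 k≡
              N , syl , eq = medium e d a≡ K≡ k≤ in
    N , syl , medium-cast N (F i) (F (2 ℕ.+ i)) (F (2 ℕ.+ k)) (F k) d (d+K≡2a e d a≡ K≡) eq) ,
  1≤r⇔ ,
  (λ 1≤r → let ρ = r ∸ 1
               r≡ = ℕ.m+[n∸m]≡n 1≤r
               a≡ = a≡K+d ρ r≡
               -- Because r is the quotient of F i - 1, the last block has one more element than the
               -- remainder and ranges over 1, ..., F k.
               N , S , syl , eq , eq₁ = small (k<i (to 1≤r⇔ 1≤r)) ρ (suc ((F i ∸ 1) ℕ.% F (2 ℕ.+ k)))
                 (ℕ.m%n<n (F i ∸ 1) (F (2 ℕ.+ k))) a≡ in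
    N , syl , subst (λ r → fromℕ N ≡ target r) r≡
      (small-cast N S (F i) (F (2 ℕ.+ i)) (F (2 ℕ.+ k)) (F k) _ ρ a≡ eq eq₁))
  where
  open Generators i k i≥3
  instance
    F≢0 = F-nonZero k≥3
  r = (F i ∸ 1) ℕ./ F (2 ℕ.+ k)
  1≤r⇔ = 1≤[Fi∸1]/Fk⇔ i (2 ℕ.+ k) i≥3
  target : ℕ → ℚ
  target r = ½ * ((fromℕ (F i) + fromℕ 2 * fromℕ (F (2 ℕ.+ k)) - 1ℚ) * fromℕ (F (2 ℕ.+ i)) - fromℕ (F i) + 1ℚ)
             - (fromℕ r * fromℕ (F i) - ½ * ((fromℕ r - 1ℚ) * (fromℕ r + fromℕ 2)) * fromℕ (F (2 ℕ.+ k))) * fromℕ (F k)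
  k<i : 2 ℕ.+ k ≤ i ∸ 1 → 2 ℕ.+ k ℕ.< i
  k<i le = ℕ.≤-<-trans le (ℕ.∸-monoʳ-< {i} ℕ.z<s (ℕ.≤-trans (s≤s z≤n) i≥3))
  d+K≡2a : ∀ e d → F i ≡ e ℕ.+ d → F (2 ℕ.+ k) ≡ F i ℕ.+ e → d ℕ.+ F (2 ℕ.+ k) ≡ 2 ℕ.* F i
  d+K≡2a e d a≡ K≡ = begin
    d ℕ.+ F (2 ℕ.+ k)    ≡⟨ cong (d ℕ.+_) K≡ ⟩
    d ℕ.+ (F i ℕ.+ e)    ≡⟨ lem d (F i) e ⟩
    F i ℕ.+ (e ℕ.+ d)    ≡⟨ cong (F i ℕ.+_) (trans (sym a≡) (sym (ℕ.+-identityʳ (F i)))) ⟩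
    2 ℕ.* F i            ∎
    where
    open ≡-Reasoning
    lem : ∀ d a e → d ℕ.+ (a ℕ.+ e) ≡ a ℕ.+ (e ℕ.+ d)
    lem = solve-∀
  a≡K+d : ∀ ρ → suc ρ ≡ r → F i ≡ F (2 ℕ.+ k) ℕ.+ (ρ ℕ.* F (2 ℕ.+ k) ℕ.+ suc ((F i ∸ 1) ℕ.% F (2 ℕ.+ k)))
  a≡K+d ρ r≡ = begin
    F i                       ≡⟨ ℕ.m+[n∸m]≡n (ℕ.>-nonZero⁻¹ (F i) {{F-nonZero i≥3}}) ⟨
    suc (F i ∸ 1)             ≡⟨ cong suc (ℕ.m≡m%n+[m/n]*n (F i ∸ 1) K) ⟩
    suc (e ℕ.+ r ℕ.* K)       ≡⟨ cong (λ s → suc (e ℕ.+ s ℕ.* K)) r≡ ⟨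
    suc (e ℕ.+ suc ρ ℕ.* K)   ≡⟨ lem e ρ K ⟩
    K ℕ.+ (ρ ℕ.* K ℕ.+ suc e) ∎
    where
    open ≡-Reasoning
    K = F (2 ℕ.+ k)
    e = (F i ∸ 1) ℕ.% K
    lem : ∀ e ρ K → suc (e ℕ.+ suc ρ ℕ.* K) ≡ K ℕ.+ (ρ ℕ.* K ℕ.+ suc e)
    lem = solve-∀
theorem10 i (suc zero) _ (s≤s ())
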